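{- Let $k\ge 0$ be an integer, let $G$ be a connected split graph, regarded as a graph of goods, and let $N=[n]$ be a set of $n\ge1$ agents with nonnegative additive utility functions $u_1,\dots,u_n$ on $V(G)$ such that the agents are of at most $2^k$ types. Then there exists a $\frac{3}{7\cdot 2^k-3}$-mms-allocation, i.e., a $(G,n)$-partition $(A_1,\dots,A_n)$ of $V(G)$ into bundles such that $u_i(A_i)\ge \frac{3}{7\cdot 2^k-3}\,\mathsf{mms}^{(n)}(G,u_i)$ for every $i\in[n]$.
   Context: A split graph is a graph whose vertex set can be partitioned into a set $K$ inducing a complete graph and an independent set $I$. Goods are the vertices of $G$. Each agent $i$ has a utility function $u_i$ assigning a nonnegative real to each vertex, extended additively to sets: $u_i(X)=\sum_{v\in X}u_i(v)$, $u_i(\emptyset)=0$. Agents are of the same type if they have the same utility function; "at most $t$ types" means the set $\{u_1,\dots,u_n\}$ has at most $t$ distinct functions. A bundle is a set $X\subseteq V(G)$ inducing a connected subgraph of $G$ (the empty set is a bundle). A $(G,n)$-partition is a tuple $(P_1,\dots,P_n)$ of pairwise disjoint bundles with $\bigcup_j P_j=V(G)$; as an allocation, $P_i$ is given to agent $i$. The maximin share is $\mathsf{mms}^{(n)}(G,u)=\max_{(P_1,\dots,P_n)}\min_{j\in[n]}u(P_j)$, the maximum over all $(G,n)$-partitions.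
   Formalization: The agents' utility functions take nonnegative rational values instead of nonnegative real values (so the maximin shares are rational as well). -}

module Defs where

open import Data.Nat as ℕ using (ℕ; zero; suc; _^_; _∸_; NonZero; >-nonZero)
open import Data.Nat.Properties using (m^n>0; *-monoʳ-≤; <-≤-trans; m<n⇒0<n∸m)
open import Data.Fin using (Fin; zero; suc; _≟_)
open import Data.Bool using (Bool; true; false; if_then_else_)
open import Data.Integer using (+_)
open import Data.Rational as ℚ using (ℚ; 0ℚ; _+_; _*_; _≤_; _/_)
open import Data.Product using (Σ; _×_; ∃; ∃-syntax)
open import Relation.Binary.PropositionalEquality using (_≡_; _≢_)
open import Relation.Nullary.Decidable using (⌊_⌋)

record Graph (m : ℕ) : Set where
  field
    adj       : Fin m → Fin m → Bool
    adj-sym   : ∀ u v → adj u v ≡ adj v u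
    adj-irrefl : ∀ v → adj v v ≡ false
open Graph public

VSet : ℕ → Set
VSet m = Fin m → Bool

data WalkIn {m : ℕ} (G : Graph m) (X : VSet m) : Fin m → Fin m → Set where
  here : ∀ {v} → X v ≡ true → WalkIn G X v v
  step : ∀ {u w v} → X u ≡ true → adj G u w ≡ true → WalkIn G X w v → WalkIn G X u v

-- X induces a connected subgraph of G (the empty set counts as connected).
IsBundle : {m : ℕ} → Graph m → VSet m → Set
IsBundle {m} G X = ∀ (u v : Fin m) → X u ≡ true → X v ≡ true → WalkIn G X u v

Connected : {m : ℕ} → Graph m → Set
Connected G = IsBundle G (λ _ → true)

IsSplit : {m : ℕ} → Graph m → Set
IsSplit {m} G = Σ (VSet m) λ inK →
    (∀ u v → inK u ≡ true → inK v ≡ true → u ≢ v → adj G u v ≡ true)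
  × (∀ u v → inK u ≡ false → inK v ≡ false → adj G u v ≡ false)

-- An n-tuple of pairwise disjoint sets covering V(G) is encoded by the map
-- sending each vertex to the index of the (unique) part containing it.
Assignment : ℕ → ℕ → Set
Assignment m n = Fin m → Fin n

part : {m n : ℕ} → Assignment m n → Fin n → VSet m
part P j v = ⌊ P v ≟ j ⌋

IsPartition : {m : ℕ} → Graph m → (n : ℕ) → Assignment m n → Set
IsPartition G n P = ∀ (j : Fin n) → IsBundle G (part P j)

Utility : ℕ → Set
Utility m = Fin m → ℚ

Nonneg : {m : ℕ} → Utility m → Set
Nonneg u = ∀ v → 0ℚ ≤ u v

sumFin : (m : ℕ) → (Fin m → ℚ) → ℚ
sumFin zero    f = 0ℚ
sumFin (suc m) f = f zero + sumFin m (λ i → f (suc i))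

value : {m : ℕ} → Utility m → VSet m → ℚ
value {m} u X = sumFin m (λ v → if X v then u v else 0ℚ)

-- μ is the maximin share mms^(n)(G,u):
-- μ = max over (G,n)-partitions P of min_j u(P_j).
IsMMS : {m : ℕ} → Graph m → (n : ℕ) → Utility m → ℚ → Set
IsMMS {m} G n u μ =
    (Σ (Assignment m n) λ P → IsPartition G n P
        × (∀ j → μ ≤ value u (part P j))
        × ∃[ j ] (value u (part P j) ≡ μ))
  × (∀ (P : Assignment m n) → IsPartition G n P →
        ∃[ j ] (value u (part P j) ≤ μ))

AtMostTypes : {m n : ℕ} → ℕ → (Fin n → Utility m) → Set
AtMostTypes {m} {n} t u =
  Σ (Fin t → Utility m) λ T → ∀ (i : Fin n) → ∃[ s ] (∀ v → u i v ≡ T s v)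

den : ℕ → ℕ
den k = 7 ℕ.* 2 ^ k ∸ 3

den>0 : ∀ k → 0 ℕ.< den k
den>0 k = m<n⇒0<n∸m {3} {7 ℕ.* 2 ^ k}
  (<-≤-trans (ℕ.s≤s (ℕ.s≤s (ℕ.s≤s (ℕ.s≤s ℕ.z≤n)))) (*-monoʳ-≤ 7 (m^n>0 2 k)))

α : ℕ → ℚ
α k = (+ 3) / den k
  where instance _ : NonZero (den k)
                 _ = >-nonZero (den>0 k)

module Submission where

-- A split graph behaves like a complete graph once every independent vertex is attached to a
-- neighbour in the clique: any union of the resulting stars is connected.  In units where the
-- satisfaction level is 3, the parts of an optimal partition of any agent are worth 7 · 2 ^ k − 3.
-- First a vertex worth 3 to an agent is given to that agent, which costs every other agent only one
-- part.  When all vertices are worth less than 3, every part meets the clique, so each type attaches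
-- each independent vertex v to a neighbour within its own part.  These attachments are merged in k
-- rounds: for two types, match in every part the largest good with the second largest, the third
-- with the fourth and so on; the union of the two matchings is bipartite, hence a choice between the
-- two types exists for which each part retains half of its value up to one good.  From
-- x to (x − 3) / 2, k times, 7 · 2 ^ k − 3 becomes 4.  So in the complete graph on the stars each
-- agent has a maximin share of 4, and it suffices to prove the 3/4-approximation for complete graphs.
--
-- There, all agents may be assumed to rank the goods in the same order (picking sequences).
-- When n agents remain, each of the sets {1}, {2n−1, 2n, 2n+1} and {1, 2n+1} can be given away if it
-- satisfies somebody.  Otherwise the bags {i, 2n+1−i} are filled up with the remaining
-- goods.  These suffice, because by convexity the bags {i, 2n+1−i} lack at most as much
-- as the large goods do in any partition into n bundles.

open import Defs
import Algebra.Solver.CommutativeMonoid as CommutativeMonoidSolver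
open import Data.Bool using (Bool; true; false; not; if_then_else_)
import Data.Bool.Properties as Boolₚ
open import Data.Fin as Fin using (Fin)
open import Data.Fin.Properties using (all?; any?; splitAt⁻¹-↑ˡ; splitAt⁻¹-↑ʳ)
import Data.Integer as ℤ
import Data.Integer.Properties as ℤₚ
open import Data.List using (List; []; _∷_; _++_; [_]; map; concat; concatMap; length; replicate; allFin; upTo; applyUpTo)
import Data.List.Membership.DecPropositional as DecMembership
open import Data.List.Membership.Propositional using (_∈_; _∉_; lose)
open import Data.List.Membership.Propositional.Properties using (∈-∃++; ∈-++⁻; ∈-++⁺ˡ; ∈-concat⁻; ∈-map⁻; ∈-allFin)
open import Data.List.Properties using (++-assoc; ++-identityʳ; length-++; length-map; length-tabulate; length-upTo; length-replicate; map-++; map-∘; map-upTo; map-tabulate)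
open import Data.List.Relation.Binary.Permutation.Propositional using (_↭_; refl; prep; swap; trans; ↭-sym; ↭-refl; ↭-reflexive)
import Data.List.Relation.Binary.Permutation.Propositional.Properties as Perm
open import Data.List.Relation.Binary.Pointwise using (Pointwise; []; _∷_)
open import Data.List.Relation.Unary.All as All using (All; []; _∷_)
import Data.List.Relation.Unary.All.Properties as Allₚ
open import Data.List.Relation.Unary.AllPairs as AllPairs using (AllPairs; []; _∷_)
import Data.List.Relation.Unary.AllPairs.Properties as AllPairsₚ
open import Data.List.Relation.Unary.Any as Any using (Any; here; there)
import Data.List.Relation.Unary.Any.Properties as Anyₚ
open import Data.List.Relation.Unary.Unique.Propositional using (Unique)
open import Data.List.Relation.Unary.Unique.Propositional.Properties using (allFin⁺)
open import Data.Maybe using (Maybe; just; nothing; fromMaybe)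
import Data.Maybe.Properties as Maybeₚ
open import Data.Nat
import Data.Nat.Coprimality as Coprime
open import Data.Nat.ListAction using (sum)
open import Data.Nat.ListAction.Properties using (sum-++; sum-↭)
open import Data.Nat.Properties
open import Data.Nat.Tactic.RingSolver using (solve-∀)
open import Data.Product using (_×_; _,_; proj₁; proj₂; ∃; ∃₂; Σ)
open import Data.Product.Properties using (≡-dec)
open import Data.Rational as ℚ using (ℚ; 0ℚ; mkℚ; *≤*; toℚᵘ)
import Data.Rational.Properties as ℚₚ
import Data.Rational.Unnormalised as ℚᵘ
import Data.Rational.Unnormalised.Properties as ℚᵘₚ
open import Data.Sum using (_⊎_; inj₁; inj₂)
open import Data.Vec as Vec using (Vec; lookup; tabulate)
open import Data.Vec.Properties using (lookup∘tabulate)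
open import Function using (id)
open import Relation.Binary.Definitions using (DecidableEquality; tri<; tri≈; tri>)
open import Relation.Binary.PropositionalEquality as ≡ using (_≡_; _≢_; ≢-sym; cong; cong₂; subst)
open import Relation.Nullary using (¬_; Dec; yes; no; contradiction)
open import Relation.Nullary.Decidable using (¬?; _×-dec_; _⊎-dec_; _→-dec_; map′; decidable-stable)
open import Relation.Unary using (Decidable)

module ↭-Solver {A : Set} = CommutativeMonoidSolver (Perm.++-commutativeMonoid {A = A})

-- Linear arithmetic by certificate: p ≤ q is a sum of hypotheses, s the slack, and the equation a
-- semiring identity.
linear : ∀ {a b} p q s → p ≤ q → a + q + s ≡ b + p → a ≤ b
linear {a} {b} p q s p≤q eq = +-cancelʳ-≤ q a b (begin
  a + q      ≤⟨ m≤m+n (a + q) s ⟩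
  a + q + s  ≡⟨ eq ⟩
  b + p      ≤⟨ +-monoʳ-≤ b p≤q ⟩
  b + q      ∎)
  where open ≤-Reasoning

-- Lists as multisets

total : {A : Set} → (A → ℕ) → List A → ℕ
total f xs = sum (map f xs)

total-↭ : ∀ {A : Set} (f : A → ℕ) {xs ys} → xs ↭ ys → total f xs ≡ total f ys
total-↭ f xs↭ys = sum-↭ (Perm.map⁺ f xs↭ys)

total-++ : ∀ {A : Set} (f : A → ℕ) xs ys → total f (xs ++ ys) ≡ total f xs + total f ys
total-++ f xs ys = ≡.trans (cong sum (map-++ f xs ys)) (sum-++ (map f xs) (map f ys))

extract : ∀ {A : Set} {x : A} {xs} → x ∈ xs → ∃ λ ys → xs ↭ x ∷ ys
extract x∈xs with ∈-∃++ x∈xs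
... | ys , zs , ≡.refl = ys ++ zs , Perm.shift _ ys zs

concat-↭ : ∀ {A : Set} {bs cs : List (List A)} → bs ↭ cs → concat bs ↭ concat cs
concat-↭ refl          = refl
concat-↭ (prep b p)    = Perm.++⁺ˡ b (concat-↭ p)
concat-↭ (swap b c p)  = trans (Perm.++⁺ˡ b (Perm.++⁺ˡ c (concat-↭ p))) (Perm.shifts b c)
concat-↭ (trans p q)   = trans (concat-↭ p) (concat-↭ q)

extract-any : ∀ {A : Set} {P : A → Set} {xs} → Any P xs → ∃₂ λ x ys → P x × xs ↭ x ∷ ys
extract-any (here {x = x} {xs = xs} px) = x , xs , px , refl
extract-any (there {x = z} any) with extract-any any
... | x , ys , px , p = x , z ∷ ys , px , trans (prep z p) (swap z x refl)

locate : ∀ {A : Set} {x : A} bs → x ∈ concat bs →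
         ∃ λ b → ∃ λ c → ∃ λ bs′ → bs ↭ b ∷ bs′ × b ↭ x ∷ c
locate bs x∈ with extract-any (∈-concat⁻ bs x∈)
... | b , bs′ , x∈b , p with extract x∈b
... | c , q = b , c , bs′ , p , q

locate-rest : ∀ {A : Set} {x : A} {b c bs bs′ xs} → bs ↭ b ∷ bs′ → b ↭ x ∷ c →
              concat bs ↭ x ∷ xs → c ++ concat bs′ ↭ xs
locate-rest {bs′ = bs′} p q r =
  Perm.drop-∷ (trans (↭-sym (trans (concat-↭ p) (Perm.++⁺ʳ (concat bs′) q))) r)

pigeonhole-> : ∀ {A : Set} k (bs : List (List A)) → length bs * k < length (concat bs) →
               Any (λ b → k < length b) bs
pigeonhole-> k (b ∷ bs) lt with k <? length b
... | yes k<b = here k<b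
... | no  k≮b = there (pigeonhole-> k bs (+-cancelˡ-< k _ _ (begin-strict
  k + length bs * k                <⟨ lt ⟩
  length (b ++ concat bs)          ≡⟨ length-++ b ⟩
  length b + length (concat bs)    ≤⟨ +-monoˡ-≤ _ (≮⇒≥ k≮b) ⟩
  k + length (concat bs)           ∎)))
  where open ≤-Reasoning

pigeonhole-< : ∀ {A : Set} k (bs : List (List A)) → length (concat bs) < length bs * k →
               Any (λ b → length b < k) bs
pigeonhole-< k (b ∷ bs) lt with length b <? k
... | yes b<k = here b<k
... | no  b≮k = there (pigeonhole-< k bs (+-cancelˡ-< k _ _ (begin-strict
  k + length (concat bs)           ≤⟨ +-monoˡ-≤ _ (≮⇒≥ b≮k) ⟩
  length b + length (concat bs)    ≡⟨ length-++ b ⟨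
  length (b ++ concat bs)          <⟨ lt ⟩
  k + length bs * k                ∎)))
  where open ≤-Reasoning

-- Reductions that preserve maximin shares

-- A maximin share of at least q in a complete graph, for one agent.  A good is represented by its
-- value, and junk lies in no bundle.
Feasible : ℕ → ℕ → List ℕ → Set
Feasible q n xs = ∃₂ λ bs junk →
  length bs ≡ n × All (λ b → q ≤ sum b) bs × concat bs ++ junk ↭ xs

Feasible-↭ : ∀ {q n xs ys} → xs ↭ ys → Feasible q n xs → Feasible q n ys
Feasible-↭ p (bs , junk , l , big , r) = bs , junk , l , big , trans r p

-- Additional goods do no harm, so the junk can join the first bundle; hence `suc n`.
cover : ∀ {q n xs} → Feasible q (suc n) xs →
        ∃ λ bs → length bs ≡ suc n × All (λ b → q ≤ sum b) bs × concat bs ↭ xs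
cover {q} (b ∷ bs , junk , l , qb ∷ big , r) = (b ++ junk) ∷ bs , l , qb′ ∷ big , trans eq r
  where
  qb′ : q ≤ sum (b ++ junk)
  qb′ = subst (q ≤_) (≡.sym (sum-++ b junk)) (m≤n⇒m≤n+o (sum junk) qb)
  eq : (b ++ junk) ++ concat bs ↭ (b ++ concat bs) ++ junk
  eq = ↭-Solver.solve 3 (λ b j c → (b ⊕ j) ⊕ c ⊜ (b ⊕ c) ⊕ j) ↭-refl b junk (concat bs)
    where open ↭-Solver

drop-bundle : ∀ {q n bs b bs′ junk xs} → length bs ≡ suc n → All (λ c → q ≤ sum c) bs →
              bs ↭ b ∷ bs′ → concat bs′ ++ junk ↭ xs → Feasible q n xs
drop-bundle l big p r =
  _ , _ , suc-injective (≡.trans (≡.sym (Perm.↭-length p)) l) , All.tail (Perm.All-resp-↭ p big) , r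

-- The loss of `x` spoils one bundle, whose other goods become junk.
Feasible-∷ : ∀ {q n x xs} → Feasible q (suc n) (x ∷ xs) → Feasible q n xs
Feasible-∷ F with cover F
... | bs , l , big , r with locate bs (Perm.∈-resp-↭ (↭-sym r) (here ≡.refl))
... | b , c , bs′ , p , q =
  drop-bundle l big p (trans (Perm.++-comm (concat bs′) c) (locate-rest p q r))

-- If x and y lie in different bundles, the remainders of these two bundles are merged.
Feasible-∷∷ : ∀ {q n x y xs} → x + y ≤ q → Feasible q (suc n) (x ∷ y ∷ xs) → Feasible q n xs
Feasible-∷∷ {q} {n} {x} {y} {xs} x+y≤q F with cover F
... | bs , l , big , r with locate bs (Perm.∈-resp-↭ (↭-sym r) (here ≡.refl))
... | b , c , bs′ , p , bc with Perm.All-resp-↭ p big | ∈-++⁻ c (Perm.∈-resp-↭ (↭-sym (locate-rest p bc r)) (here ≡.refl))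
... | qb ∷ big′ | inj₁ y∈c with extract y∈c
... | d , cd = drop-bundle l big p (trans (Perm.++-comm (concat bs′) d)
  (Perm.drop-∷ (trans (Perm.++⁺ʳ (concat bs′) (↭-sym cd)) (locate-rest p bc r))))
Feasible-∷∷ {q} {n} {x} {y} {xs} x+y≤q F | bs , l , big , r | b , c , bs′ , p , bc | qb ∷ big′ | inj₂ y∈bs′
  with locate bs′ y∈bs′
... | e , d , bs″ , p′ , ed with Perm.All-resp-↭ p′ big′
... | qe ∷ big″ = (c ++ d) ∷ bs″ , [] , len , merged ∷ big″ , perm
  where
  len : suc (length bs″) ≡ n
  len = ≡.trans (≡.sym (Perm.↭-length p′)) (suc-injective (≡.trans (≡.sym (Perm.↭-length p)) l))
  -- The two bundles were worth `2q` together, and `x + y ≤ q` of it is lost.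
  merged : q ≤ sum (c ++ d)
  merged = subst (q ≤_) (≡.sym (sum-++ c d))
    (linear _ _ 0 (+-mono-≤ (+-mono-≤ x+y≤q (≤-trans qb (≤-reflexive (sum-↭ bc)))) (≤-trans qe (≤-reflexive (sum-↭ ed))))
      (identity q x y (sum c) (sum d)))
    where
    identity : ∀ q x y c d → q + (q + (x + c) + (y + d)) + 0 ≡ c + d + (x + y + q + q)
    identity = solve-∀
  perm : ((c ++ d) ++ concat bs″) ++ [] ↭ xs
  perm = Perm.drop-∷ {x = y} (trans
    (↭-Solver.solve 4 (λ y c d s → y ⊕ (((c ⊕ d) ⊕ s) ⊕ ↭-Solver.id) ⊜ c ⊕ ((y ⊕ d) ⊕ s)) ↭-refl [ y ] c d (concat bs″))
    (trans (Perm.++⁺ˡ c (trans (Perm.++⁺ʳ (concat bs″) (↭-sym ed)) (↭-sym (concat-↭ p′)))) (locate-rest p bc r)))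
    where open ↭-Solver hiding (id)

Feasible-raise : ∀ {q n x y xs} → x ≤ y → Feasible q n (x ∷ xs) → Feasible q n (y ∷ xs)
Feasible-raise {q} {n} {x} {y} {xs} x≤y (bs , junk , l , big , r)
  with ∈-++⁻ (concat bs) (Perm.∈-resp-↭ (↭-sym r) (here ≡.refl))
... | inj₂ x∈junk with extract x∈junk
... | junk′ , j = bs , y ∷ junk′ , l , big ,
  trans (Perm.shift y (concat bs) junk′) (prep y (Perm.drop-∷
    (trans (↭-sym (trans (Perm.++⁺ˡ (concat bs) j) (Perm.shift x (concat bs) junk′))) r)))
Feasible-raise {q} {n} {x} {y} {xs} x≤y (bs , junk , l , big , r) | inj₁ x∈bs with locate bs x∈bs
... | b , c , bs′ , p , bc with Perm.All-resp-↭ p big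
... | qb ∷ big′ = (y ∷ c) ∷ bs′ , junk , ≡.trans (≡.sym (Perm.↭-length p)) l ,
  ≤-trans (≤-trans qb (≤-reflexive (sum-↭ bc))) (+-monoˡ-≤ (sum c) x≤y) ∷ big′ ,
  prep y (Perm.drop-∷ (trans (↭-sym (Perm.++⁺ʳ junk (trans (concat-↭ p) (Perm.++⁺ʳ (concat bs′) bc)))) r))

AllPairs-++⁻ˡ : ∀ {A : Set} {R : A → A → Set} xs {ys} → AllPairs R (xs ++ ys) → AllPairs R xs
AllPairs-++⁻ˡ []       _        = []
AllPairs-++⁻ˡ (_ ∷ xs) (r ∷ rs) = Allₚ.++⁻ˡ xs r ∷ AllPairs-++⁻ˡ xs rs

AllPairs-++⁻ʳ : ∀ {A : Set} {R : A → A → Set} xs {ys} → AllPairs R (xs ++ ys) → AllPairs R ys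
AllPairs-++⁻ʳ []       rs       = rs
AllPairs-++⁻ʳ (_ ∷ xs) (_ ∷ rs) = AllPairs-++⁻ʳ xs rs

AllPairs-delete : ∀ {A : Set} {R : A → A → Set} xs {y ys} → AllPairs R (xs ++ y ∷ ys) → AllPairs R (xs ++ ys)
AllPairs-delete []       (_ ∷ ps) = ps
AllPairs-delete (x ∷ xs) (p ∷ ps) = All-delete xs p ∷ AllPairs-delete xs ps
  where
  All-delete : ∀ {A : Set} {P : A → Set} xs {y ys} → All P (xs ++ y ∷ ys) → All P (xs ++ ys)
  All-delete xs p = Allₚ.++⁺ (Allₚ.++⁻ˡ xs p) (All.tail (Allₚ.++⁻ʳ xs p))

-- Removing the smallest goods hurts less than removing any other goods ks of the same number.
Feasible-swap : ∀ {q n} ks ls {os is rest} → length ks ≡ length ls → ks ++ os ↭ ls ++ is →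
                AllPairs _≥_ ls → All (λ l → All (l ≤_) is) ls →
                Feasible q n (os ++ rest) → Feasible q n (is ++ rest)
Feasible-swap [] [] {rest = rest} _ p _ _ F = Feasible-↭ (Perm.++⁺ʳ rest p) F
Feasible-swap (k ∷ ks) (l ∷ ls) {os} {is} {rest} eq p (l≥ ∷ desc) (l≤ ∷ low) F
  with ∈-++⁻ (l ∷ ls) (Perm.∈-resp-↭ p (here ≡.refl))
-- `k` has to come back. In the recursive call `l` holds its place and is afterwards raised to `k`.
-- As `ls` descends, `l` is no smaller than the rest of `ls`, which restores `low`.
... | inj₂ k∈is with extract k∈is
... | is′ , q = Feasible-↭ (Perm.++⁺ʳ rest (↭-sym q)) (Feasible-raise (All.lookup l≤ k∈is)
  (Feasible-swap ks ls (suc-injective eq)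
    (Perm.drop-∷ (trans p (trans (prep l (Perm.++⁺ˡ ls q))
      (↭-Solver.solve 4 (λ l ls k is → l ⊕ (ls ⊕ (k ⊕ is)) ⊜ k ⊕ (ls ⊕ (l ⊕ is))) ↭-refl [ l ] ls [ k ] is′))))
    desc (All.zipWith (λ (a , b) → a ∷ All.tail (Perm.All-resp-↭ q b)) (l≥ , low)) F))
  where open ↭-Solver
Feasible-swap (k ∷ ks) (l ∷ ls) {os} {is} {rest} eq p desc low F | inj₁ k∈ls with ∈-∃++ k∈ls
... | as , bs , eq′ =
  Feasible-swap ks (as ++ bs) len
    (Perm.drop-∷ (trans p (trans (↭-reflexive (cong (_++ is) eq′)) (Perm.++⁺ʳ is (Perm.shift k as bs)))))
    (AllPairs-delete as (subst (AllPairs _≥_) eq′ desc))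
    (let low′ = subst (All _) eq′ low in Allₚ.++⁺ (Allₚ.++⁻ˡ as low′) (All.tail (Allₚ.++⁻ʳ as low′))) F
  where
  len : length ks ≡ length (as ++ bs)
  len = suc-injective (≡.trans eq (≡.trans (cong length eq′) (Perm.↭-length (Perm.shift k as bs))))

-- A bundle, cut into its goods from `top` and its goods from `rest`.
Parts : Set → Set
Parts A = List A × List A

-- Refinement of multisets. Each good of `b` is charged to one occurrence in `top` or in `rest`;
-- occurrences are tracked because equal values may lie on both sides.
deal-one : ∀ {A : Set} (b : List A) {cs} top rest → b ++ cs ↭ top ++ rest →
           ∃₂ λ s t → ∃₂ λ top′ rest′ →
           b ↭ s ++ t × top ↭ s ++ top′ × rest ↭ t ++ rest′ × cs ↭ top′ ++ rest′
deal-one [] top rest p = [] , [] , top , rest , refl , refl , refl , p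
deal-one (x ∷ b) top rest p with ∈-++⁻ top (Perm.∈-resp-↭ p (here ≡.refl))
... | inj₁ x∈top with extract x∈top
... | top₁ , q with deal-one b top₁ rest (Perm.drop-∷ (trans p (Perm.++⁺ʳ rest q)))
... | s , t , top′ , rest′ , b↭ , top↭ , rest↭ , cs↭ =
  x ∷ s , t , top′ , rest′ , prep x b↭ , trans q (prep x top↭) , rest↭ , cs↭
deal-one (x ∷ b) top rest p | inj₂ x∈rest with extract x∈rest
... | rest₁ , q with deal-one b top rest₁ (Perm.drop-∷ (trans p (trans (Perm.++⁺ˡ top q) (Perm.shift x top rest₁))))
... | s , t , top′ , rest′ , b↭ , top↭ , rest↭ , cs↭ =
  s , x ∷ t , top′ , rest′ , trans (prep x b↭) (↭-sym (Perm.shift x s t)) , top↭ , trans q (prep x rest↭) , cs↭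

deal : ∀ {A : Set} (bs : List (List A)) top rest → concat bs ↭ top ++ rest →
       ∃ λ (qs : List (Parts A)) → Pointwise (λ b q → b ↭ proj₁ q ++ proj₂ q) bs qs ×
       concat (map proj₁ qs) ↭ top × concat (map proj₂ qs) ↭ rest
deal [] top rest p with Perm.↭-empty-inv (↭-sym p)
deal [] [] [] p | _ = [] , [] , refl , refl
deal (b ∷ bs) top rest p with deal-one b top rest p
... | s , t , top′ , rest′ , b↭ , top↭ , rest↭ , cs↭ with deal bs top′ rest′ cs↭
... | qs , pw , l , r = (s , t) ∷ qs , b↭ ∷ pw ,
  trans (Perm.++⁺ˡ s l) (↭-sym top↭) , trans (Perm.++⁺ˡ t r) (↭-sym rest↭)

FeasibleParts : ℕ → ℕ → List ℕ → List ℕ → Set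
FeasibleParts q n top rest = ∃ λ (qs : List (Parts ℕ)) →
  length qs ≡ n × All (λ (s , t) → q ≤ sum s + sum t) qs ×
  concat (map proj₁ qs) ↭ top × concat (map proj₂ qs) ↭ rest

parts : ∀ {q n} top rest → Feasible q (suc n) (top ++ rest) → FeasibleParts q (suc n) top rest
parts {q} top rest F with cover F
... | bs , l , big , p with deal bs top rest p
... | qs , pw , t , r = qs , ≡.trans (≡.sym (Pointwise-len pw)) l , bigs pw big , t , r
  where
  Pointwise-len : ∀ {bs : List (List ℕ)} {qs : List (Parts ℕ)} {R : List ℕ → Parts ℕ → Set} →
                  Pointwise R bs qs → length bs ≡ length qs
  Pointwise-len []       = ≡.refl
  Pointwise-len (_ ∷ pw) = cong suc (Pointwise-len pw)
  bigs : ∀ {bs qs} → Pointwise (λ b (q : Parts ℕ) → b ↭ proj₁ q ++ proj₂ q) bs qs →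
         All (λ b → q ≤ sum b) bs → All (λ (s , t) → q ≤ sum s + sum t) qs
  bigs [] [] = []
  bigs {qs = (s , t) ∷ _} (p ∷ pw) (b ∷ bs) =
    subst (q ≤_) (≡.trans (sum-↭ p) (sum-++ s t)) b ∷ bigs pw bs

-- With more than two goods of `top` per bundle, some bundle contains three of them. That bundle is
-- dissolved: three goods `ks` disappear and its other goods become junk.
Feasible-triple : ∀ {q n} top rest → suc n * 2 < length top → Feasible q (suc n) (top ++ rest) →
                  ∃₂ λ ks os → length ks ≡ 3 × top ↭ ks ++ os × Feasible q n (os ++ rest)
Feasible-triple {q} {n} top rest lt F with parts top rest F
... | qs , l , big , t , r with extract-any (Anyₚ.map⁻ (pigeonhole-> 2 (map proj₁ qs) lt′))
  where
  lt′ : length (map proj₁ qs) * 2 < length (concat (map proj₁ qs))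
  lt′ = ≡.subst₂ _<_ (cong (_* 2) (≡.sym (≡.trans (length-map proj₁ qs) l))) (≡.sym (Perm.↭-length t)) lt
... | (a ∷ b ∷ c ∷ s , u) , qs′ , s≤s (s≤s (s≤s _)) , p with Perm.All-resp-↭ p big
... | _ ∷ big′ = a ∷ b ∷ c ∷ [] , s ++ concat (map proj₁ qs′) , ≡.refl ,
    trans (↭-sym t) (concat-↭ (Perm.map⁺ proj₁ p)) ,
    map (λ (s , t) → s ++ t) qs′ , s ++ u ,
    ≡.trans (length-map _ qs′) (suc-injective (≡.trans (≡.sym (Perm.↭-length p)) l)) ,
    Allₚ.map⁺ (All.map (λ {(s , t)} h → subst (q ≤_) (≡.sym (sum-++ s t)) h) big′) ,
    trans (Perm.++⁺ʳ (s ++ u) (unzip qs′))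
      (trans (↭-Solver.solve 4 (λ s u x y → (x ⊕ y) ⊕ (s ⊕ u) ⊜ (s ⊕ x) ⊕ (u ⊕ y)) ↭-refl s u (concat (map proj₁ qs′)) (concat (map proj₂ qs′)))
        (Perm.++⁺ˡ (s ++ concat (map proj₁ qs′)) (trans (↭-sym (concat-↭ (Perm.map⁺ proj₂ p))) r)))
  where
  open ↭-Solver
  unzip : ∀ (qs : List (Parts ℕ)) → concat (map (λ (s , t) → s ++ t) qs) ↭ concat (map proj₁ qs) ++ concat (map proj₂ qs)
  unzip [] = refl
  unzip ((s , t) ∷ qs) = trans (Perm.++⁺ˡ (s ++ t) (unzip qs))
    (↭-Solver.solve 4 (λ s t x y → (s ⊕ t) ⊕ (x ⊕ y) ⊜ (s ⊕ x) ⊕ (t ⊕ y)) ↭-refl s t (concat (map proj₁ qs)) (concat (map proj₂ qs)))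

-- Pairing the large goods

-- Convexity of `t ∸_`, at the points 0, `d`, `e` and `e + d`.
∸-swap : ∀ t d e → (t ∸ e) + (t ∸ d) ≤ (t ∸ (e + d)) + t
∸-swap t d e with ≤-total d t
... | inj₁ d≤t = begin
  (t ∸ e) + (t ∸ d)              ≤⟨ +-monoˡ-≤ (t ∸ d) (m≤n+m∸n (t ∸ e) d) ⟩
  (d + (t ∸ e ∸ d)) + (t ∸ d)    ≡⟨ cong (λ z → (d + z) + (t ∸ d)) (∸-+-assoc t e d) ⟩
  (d + (t ∸ (e + d))) + (t ∸ d)  ≡⟨ shuffle d (t ∸ (e + d)) (t ∸ d) ⟩
  (t ∸ (e + d)) + (d + (t ∸ d))  ≡⟨ cong ((t ∸ (e + d)) +_) (m+[n∸m]≡n d≤t) ⟩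
  (t ∸ (e + d)) + t              ∎
  where
  open ≤-Reasoning
  shuffle : ∀ a b c → (a + b) + c ≡ b + (a + c)
  shuffle = solve-∀
... | inj₂ t≤d = begin
  (t ∸ e) + (t ∸ d)  ≡⟨ cong ((t ∸ e) +_) (m≤n⇒m∸n≡0 t≤d) ⟩
  (t ∸ e) + 0        ≡⟨ +-identityʳ _ ⟩
  t ∸ e              ≤⟨ m∸n≤m t e ⟩
  t                  ≤⟨ m≤n+m t _ ⟩
  (t ∸ (e + d)) + t  ∎
  where open ≤-Reasoning

-- The sums `x + s` and `y + z` lie between `s + z` and `x + y` and have the same total, so this is
-- `∸-swap` for `c ∸ (s + z)`.
∸-exchange : ∀ c {x y z s} → z ≤ x → s ≤ y →
             (c ∸ (x + s)) + (c ∸ (y + z)) ≤ (c ∸ (x + y)) + (c ∸ (s + z))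
∸-exchange c {z = z} {s} z≤x s≤y with m≤n⇒∃[o]m+o≡n z≤x | m≤n⇒∃[o]m+o≡n s≤y
... | e , ≡.refl | d , ≡.refl = ≡.subst₂ _≤_
  (cong₂ _+_ (fold e (i₁ s z e)) (fold d (i₂ s z d)))
  (cong (_+ (c ∸ (s + z))) (fold (e + d) (i₃ s z e d)))
  (∸-swap (c ∸ (s + z)) d e)
  where
  fold : ∀ u {w} → s + z + u ≡ w → c ∸ (s + z) ∸ u ≡ c ∸ w
  fold u eq = ≡.trans (∸-+-assoc c (s + z) u) (cong (c ∸_) eq)
  i₁ : ∀ s z e → s + z + e ≡ z + e + s
  i₁ = solve-∀
  i₂ : ∀ s z d → s + z + d ≡ s + d + z
  i₂ = solve-∀
  i₃ : ∀ s z e d → s + z + (e + d) ≡ z + e + (s + d)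
  i₃ = solve-∀

∸-shift : ∀ c p w → c ∸ p ≤ w + (c ∸ (p + w))
∸-shift c p w = subst (c ∸ p ≤_) (cong (w +_) (∸-+-assoc c p w)) (m≤n+m∸n (c ∸ p) w)

extract-min : ∀ x xs → ∃₂ λ y ys → x ∷ xs ↭ y ∷ ys × All (y ≤_) ys × length ys ≡ length xs
extract-min x [] = x , [] , refl , [] , ≡.refl
extract-min x (z ∷ xs) with extract-min z xs
... | y , ys , p , y≤ , l with ≤-total x y
... | inj₁ x≤y = x , y ∷ ys , prep x p , x≤y ∷ All.map (≤-trans x≤y) y≤ , cong suc l
... | inj₂ y≤x = y , x ∷ ys , trans (prep x p) (swap x y refl) , y≤x ∷ y≤ , cong suc l

record Smallest (A : List ℕ) : Set where
  constructor smallest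
  field
    y z w : ℕ
    A′    : List ℕ
    perm  : A ↭ y ∷ z ∷ w ∷ A′
    y≤z   : y ≤ z
    z≤w   : z ≤ w
    y≤A′  : All (y ≤_) A′

two-smallest : ∀ A → 2 < length A → Smallest A
two-smallest (a ∷ b ∷ c ∷ A) _ with extract-min a (b ∷ c ∷ A)
... | y , z₀ ∷ ys , p , y≤ , l with extract-min z₀ ys
... | z , w ∷ A′ , p′ , z≤w ∷ _ , l′ with Perm.All-resp-↭ p′ y≤
... | y≤z ∷ _ ∷ y≤A′ = smallest y z w A′ (trans p (prep y p′)) y≤z z≤w y≤A′
two-smallest (a ∷ b ∷ c ∷ A) _ | y , z₀ ∷ [] , p , y≤ , () | z , [] , p′ , _ , l′
two-smallest (a ∷ b ∷ c ∷ A) _ | y , z₀ ∷ _ ∷ ys , p , y≤ , l | z , [] , p′ , _ , ()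
two-smallest (a ∷ b ∷ [])  (s≤s (s≤s ()))
two-smallest (a ∷ [])  (s≤s ())

flatten : {A : Set} → List (A × A) → List A
flatten = concatMap (λ (x , y) → x ∷ y ∷ [])

pairDeficit : ℕ → ℕ × ℕ → ℕ
pairDeficit c (x , y) = c ∸ (x + y)

-- The amount missing in a bundle; bundles with at least two goods are held to the lower standard
-- c ≤ q only, which leaves room for replacing bundles of three or more goods by pairs.
deficit : ℕ → ℕ → List ℕ → ℕ
deficit q c []           = q
deficit q c (x ∷ [])     = q ∸ x
deficit q c xs@(_ ∷ _ ∷ _) = c ∸ sum xs

deficit-↭ : ∀ q c {xs ys} → xs ↭ ys → deficit q c xs ≡ deficit q c ys
deficit-↭ q c {[]} p with Perm.↭-empty-inv (↭-sym p)
... | ≡.refl = ≡.refl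
deficit-↭ q c {x ∷ []} p with Perm.↭-singleton-inv (↭-sym p)
... | ≡.refl = ≡.refl
deficit-↭ q c {x ∷ x′ ∷ xs} {[]} p with Perm.↭-length p
... | ()
deficit-↭ q c {x ∷ x′ ∷ xs} {y ∷ []} p with Perm.↭-length p
... | ()
deficit-↭ q c {x ∷ x′ ∷ xs} {y ∷ y′ ∷ ys} p = cong (c ∸_) (sum-↭ p)

deficit≤ : ∀ {q c} → c ≤ q → ∀ xs → deficit q c xs ≤ q ∸ sum xs
deficit≤ c≤q []           = ≤-refl
deficit≤ {q} c≤q (x ∷ []) = ≤-reflexive (cong (q ∸_) (≡.sym (+-identityʳ x)))
deficit≤ c≤q xs@(_ ∷ _ ∷ _) = ∸-monoˡ-≤ (sum xs) c≤q

-- The bags {i, 2n+1-i}, peeled off from the outside to the inside.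
data Outer {A : Set} : List A → List (A × A) → Set where
  []  : Outer [] []
  out : ∀ {x s ms ps} → Outer ms ps → Outer (x ∷ ms ++ [ s ]) ((x , s) ∷ ps)

Outer-map : ∀ {A B : Set} (f : A → B) {xs ps} → Outer xs ps → Outer (map f xs) (map (λ (x , y) → f x , f y) ps)
Outer-map f [] = []
Outer-map f (out {x} {s} {ms} o) = subst (λ t → Outer (f x ∷ t) _) (≡.sym (map-++ f ms [ s ])) (out (Outer-map f o))

snoc-view : ∀ {A : Set} (x : A) xs → ∃₂ λ ms s → x ∷ xs ≡ ms ++ [ s ]
snoc-view x []       = [] , x , ≡.refl
snoc-view x (y ∷ xs) with snoc-view y xs
... | ms , s , eq = x ∷ ms , s , cong (x ∷_) eq

outer-pairs : ∀ {A : Set} n (xs : List A) → length xs ≡ n * 2 → ∃ λ ps → Outer xs ps × length ps ≡ n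
outer-pairs zero [] _ = [] , [] , ≡.refl
outer-pairs (suc n) (x ∷ y ∷ xs) l with snoc-view y xs
... | ms , s , eq with outer-pairs n ms (suc-injective (≡.trans (≡.sym (≡.trans (cong length eq) (≡.trans (length-++ ms) (+-comm _ 1)))) (suc-injective l)))
... | ps , o , l′ = (x , s) ∷ ps , subst (λ t → Outer (x ∷ t) _) (≡.sym eq) (out o) , cong suc l′

Outer-↭ : ∀ {A : Set} {xs : List A} {ps} → Outer xs ps → flatten ps ↭ xs
Outer-↭ [] = refl
Outer-↭ (out {x} {s} {ms} o) = prep x (trans (prep s (Outer-↭ o)) (Perm.∷↭∷ʳ s ms))

locate-pair : ∀ {A : Set} {x : A} {xs} ps → flatten ps ↭ x ∷ xs →
              ∃₂ λ y qs → (ps ↭ (x , y) ∷ qs ⊎ ps ↭ (y , x) ∷ qs) × y ∷ flatten qs ↭ xs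
locate-pair {x = x} ps p = go ps (Perm.∈-resp-↭ (↭-sym p) (here ≡.refl)) p
  where
  go : ∀ {xs} ps → x ∈ flatten ps → flatten ps ↭ x ∷ xs →
       ∃₂ λ y qs → (ps ↭ (x , y) ∷ qs ⊎ ps ↭ (y , x) ∷ qs) × y ∷ flatten qs ↭ xs
  go ((a , b) ∷ ps) (here ≡.refl) p = b , ps , inj₁ refl , Perm.drop-∷ p
  go ((a , b) ∷ ps) (there (here ≡.refl)) p = a , ps , inj₂ refl , Perm.drop-∷ (trans (swap b a refl) p)
  go ((a , b) ∷ ps) (there (there x∈)) p with extract x∈
  ... | zs , pz with go ps x∈ pz
  ... | y , qs , e , r = y , (a , b) ∷ qs , e′ e ,
    Perm.drop-∷ (trans (trans (↭-Solver.solve 5 (λ x y a b q → x ⊕ (y ⊕ (a ⊕ (b ⊕ q))) ⊜ a ⊕ (b ⊕ (x ⊕ (y ⊕ q)))) ↭-refl [ x ] [ y ] [ a ] [ b ] (flatten qs))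
      (prep a (prep b (trans (prep x r) (↭-sym pz))))) p)
    where
    open ↭-Solver
    push : ∀ {p} → ps ↭ p ∷ qs → (a , b) ∷ ps ↭ p ∷ (a , b) ∷ qs
    push h = trans (prep _ h) (swap _ _ refl)
    e′ : ps ↭ (x , y) ∷ qs ⊎ ps ↭ (y , x) ∷ qs →
         (a , b) ∷ ps ↭ (x , y) ∷ (a , b) ∷ qs ⊎ (a , b) ∷ ps ↭ (y , x) ∷ (a , b) ∷ qs
    e′ (inj₁ h) = inj₁ (push h)
    e′ (inj₂ h) = inj₂ (push h)

total-pair : ∀ c {x y ps qs} → ps ↭ (x , y) ∷ qs ⊎ ps ↭ (y , x) ∷ qs →
             total (pairDeficit c) ps ≡ (c ∸ (x + y)) + total (pairDeficit c) qs
total-pair c (inj₁ p) = total-↭ (pairDeficit c) p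
total-pair c {x} {y} {qs = qs} (inj₂ p) =
  ≡.trans (total-↭ (pairDeficit c) p) (cong (λ t → (c ∸ t) + total (pairDeficit c) qs) (+-comm y x))

AllPairs-last : ∀ {A : Set} {R : A → A → Set} ms {s} → AllPairs R (ms ++ [ s ]) → All (λ x → R x s) ms
AllPairs-last []       _        = []
AllPairs-last (m ∷ ms) (r ∷ rs) = All.head (Allₚ.++⁻ʳ ms r) ∷ AllPairs-last ms rs

-- Pairing the largest with the smallest good minimises the total deficit, since c ∸_ is convex.
outer-minimal : ∀ c {xs qs} ps → Outer xs qs → AllPairs _≥_ xs → flatten ps ↭ xs →
                total (pairDeficit c) qs ≤ total (pairDeficit c) ps
outer-minimal c ps [] _ _ = z≤n
outer-minimal c ps (out {x} {s} {ms} {qs} o) (x≥ ∷ desc) p with locate-pair ps p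
... | y , ps₁ , e , p₁ with Perm.∈-resp-↭ (↭-sym (trans p₁ (↭-sym (Perm.∷↭∷ʳ s ms)))) (here ≡.refl)
... | here ≡.refl = begin
    (c ∸ (x + s)) + total φ qs    ≤⟨ +-monoʳ-≤ (c ∸ (x + s)) (outer-minimal c ps₁ o (AllPairs-++⁻ˡ ms desc) p₂) ⟩
    (c ∸ (x + s)) + total φ ps₁   ≡⟨ total-pair c e ⟨
    total φ ps                    ∎
  where
  open ≤-Reasoning
  φ = pairDeficit c
  p₂ : flatten ps₁ ↭ ms
  p₂ = Perm.drop-∷ (trans p₁ (↭-sym (Perm.∷↭∷ʳ s ms)))
... | there s∈ with extract s∈
... | zs , pz with locate-pair ps₁ pz
... | z , ps₂ , e₂ , p₂ = begin
    (c ∸ (x + s)) + total φ qs                       ≤⟨ +-monoʳ-≤ (c ∸ (x + s)) (outer-minimal c ((y , z) ∷ ps₂) o (AllPairs-++⁻ˡ ms desc) p₃) ⟩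
    (c ∸ (x + s)) + ((c ∸ (y + z)) + total φ ps₂)    ≡⟨ +-assoc (c ∸ (x + s)) _ _ ⟨
    (c ∸ (x + s)) + (c ∸ (y + z)) + total φ ps₂      ≤⟨ +-monoˡ-≤ (total φ ps₂) (∸-exchange c z≤x s≤y) ⟩
    (c ∸ (x + y)) + (c ∸ (s + z)) + total φ ps₂      ≡⟨ +-assoc (c ∸ (x + y)) _ _ ⟩
    (c ∸ (x + y)) + ((c ∸ (s + z)) + total φ ps₂)    ≡⟨ cong ((c ∸ (x + y)) +_) (total-pair c e₂) ⟨
    (c ∸ (x + y)) + total φ ps₁                      ≡⟨ total-pair c e ⟨
    total φ ps                                       ∎
  where
  open ≤-Reasoning
  φ = pairDeficit c
  p₃ : y ∷ z ∷ flatten ps₂ ↭ ms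
  p₃ = Perm.drop-∷ (trans (swap s y (p₂)) (trans (prep y (↭-sym pz)) (trans p₁ (↭-sym (Perm.∷↭∷ʳ s ms)))))
  s≤y : s ≤ y
  s≤y = All.lookup (AllPairs-last ms desc) (Perm.∈-resp-↭ p₃ (here ≡.refl))
  z≤x : z ≤ x
  z≤x = All.lookup x≥ (∈-++⁺ˡ (Perm.∈-resp-↭ p₃ (there (here ≡.refl))))

-- Here `q` is the maximin share, `3 * μ` the satisfaction level and `θ` bounds the small goods. A
-- bag that receives small goods one at a time until it reaches `3 * μ` does not exceed `c`, unless
-- it did so from the start; hence deficits are measured against `c`.
module _ (μ θ q c : ℕ) (q≡ : q ≡ 4 * μ) (c≡ : c ≡ 3 * μ + θ) (θ≤μ : θ ≤ μ) where

  private
    c≤q : c ≤ q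
    c≤q = ≡.subst₂ _≤_ (≡.sym c≡) (≡.sym q≡) (linear θ μ 0 θ≤μ (identity μ θ))
      where
      identity : ∀ μ θ → 3 * μ + θ + μ + 0 ≡ 4 * μ + θ
      identity = solve-∀
    ψ : List ℕ → ℕ
    ψ = deficit q c

    -- An exchange towards bundles with exactly two large goods: an overfull `A` and an underfull
    -- `B` become one pair and one remainder.
    record Repair (A B : List ℕ) : Set where
      constructor repair
      field
        pair   : ℕ × ℕ
        C      : List ℕ
        perm   : proj₁ pair ∷ proj₂ pair ∷ C ↭ A ++ B
        better : pairDeficit c pair + ψ C ≤ ψ A + ψ B

    -- The pair lacks more than `A` did by at most the value of the remainder `w ∷ A′`, and the
    -- empty bundle gains that much, unless its deficit vanishes; but then the pair lacks at most
    -- `c ≤ q`. The cases differ because a single good is held to `q` and a longer remainder to `c`.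
    repair-empty : ∀ A → 2 < length A → Repair A []
    repair-empty A lt with two-smallest A lt
    ... | smallest y z w A′ perm y≤z z≤w y≤A′ =
      repair (y , z) (w ∷ A′) (trans (↭-sym perm) (↭-reflexive (≡.sym (++-identityʳ A))))
        (subst (λ t → pairDeficit c (y , z) + ψ (w ∷ A′) ≤ t + q) (≡.sym (deficit-↭ q c perm)) (bound A′ y≤A′))
      where
      open ≤-Reasoning
      bound : ∀ A′ → All (y ≤_) A′ → (c ∸ (y + z)) + ψ (w ∷ A′) ≤ (c ∸ (y + (z + (w + sum A′)))) + q
      bound [] _ = begin
        (c ∸ (y + z)) + (q ∸ w)              ≤⟨ ∸-swap′ ⟩
        (c ∸ (y + z + w)) + q                ≡⟨ cong (λ t → (c ∸ t) + q) (assoc y z w) ⟩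
        (c ∸ (y + (z + (w + 0)))) + q        ∎
        where
        assoc : ∀ y z w → y + z + w ≡ y + (z + (w + 0))
        assoc = solve-∀
        ∸-swap′ : (c ∸ (y + z)) + (q ∸ w) ≤ (c ∸ (y + z + w)) + q
        ∸-swap′ with ≤-total w q
        ... | inj₁ w≤q = begin
          (c ∸ (y + z)) + (q ∸ w)              ≤⟨ +-monoˡ-≤ _ (∸-shift c (y + z) w) ⟩
          (w + (c ∸ (y + z + w))) + (q ∸ w)    ≡⟨ shuffle w (c ∸ (y + z + w)) (q ∸ w) ⟩
          (c ∸ (y + z + w)) + (w + (q ∸ w))    ≡⟨ cong ((c ∸ (y + z + w)) +_) (m+[n∸m]≡n w≤q) ⟩
          (c ∸ (y + z + w)) + q                ∎
          where
          shuffle : ∀ a b c → (a + b) + c ≡ b + (a + c)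
          shuffle = solve-∀
        ... | inj₂ q≤w = begin
          (c ∸ (y + z)) + (q ∸ w)    ≡⟨ cong ((c ∸ (y + z)) +_) (m≤n⇒m∸n≡0 q≤w) ⟩
          (c ∸ (y + z)) + 0          ≡⟨ +-identityʳ _ ⟩
          c ∸ (y + z)                ≤⟨ ≤-trans (m∸n≤m c (y + z)) c≤q ⟩
          q                          ≤⟨ m≤n+m q _ ⟩
          (c ∸ (y + z + w)) + q      ∎
      bound (a ∷ A″) (y≤a ∷ _) = begin
        (c ∸ (y + z)) + (c ∸ r)          ≡⟨ +-comm (c ∸ (y + z)) _ ⟩
        (c ∸ r) + (c ∸ (y + z))          ≤⟨ ∸-swap c (y + z) r ⟩
        (c ∸ (r + (y + z))) + c          ≡⟨ cong (λ t → (c ∸ t) + c) (+-comm r _) ⟩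
        (c ∸ (y + z + r)) + c            ≤⟨ +-monoʳ-≤ _ c≤q ⟩
        (c ∸ (y + z + r)) + q            ≡⟨ cong (λ t → (c ∸ t) + q) (+-assoc y z r) ⟩
        (c ∸ (y + (z + r))) + q          ∎
        where
        r = w + (a + sum A″)

    -- The smallest good `y` of `A` moves over to `b`. What `A` loses is gained by `b`, as long as
    -- the pair does not overshoot `q`.
    repair-single : ∀ A b → 2 < length A → b + θ ≤ 3 * μ → Repair A [ b ]
    repair-single A b lt b≤ with two-smallest A lt
    ... | smallest y z w A′ perm y≤z z≤w y≤A′ =
      repair (b , y) (z ∷ w ∷ A′)
        (trans (prep b (↭-sym perm)) (Perm.∷↭∷ʳ b A))
        (subst (λ t → (c ∸ (b + y)) + (c ∸ r) ≤ t + (q ∸ b)) (≡.sym (deficit-↭ q c perm)) bound)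
      where
      open ≤-Reasoning
      r = z + (w + sum A′)
      2y≤r : y + y ≤ r
      2y≤r = +-mono-≤ y≤z (m≤n⇒m≤n+o (sum A′) (≤-trans y≤z z≤w))
      bound : (c ∸ (b + y)) + (c ∸ r) ≤ (c ∸ (y + r)) + (q ∸ b)
      bound with ≤-total (b + y) q
      ... | inj₁ b+y≤q = begin
        (c ∸ (b + y)) + (c ∸ r)              ≤⟨ +-mono-≤ (∸-monoˡ-≤ (b + y) c≤q) (∸-shift c r y) ⟩
        (q ∸ (b + y)) + (y + (c ∸ (r + y)))  ≡⟨ shuffle (q ∸ (b + y)) y (c ∸ (r + y)) ⟩
        (c ∸ (r + y)) + (y + (q ∸ (b + y)))  ≡⟨ cong₂ (λ s t → (c ∸ s) + (y + t)) (+-comm r y) (≡.sym (∸-+-assoc q b y)) ⟩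
        (c ∸ (y + r)) + (y + (q ∸ b ∸ y))    ≡⟨ cong ((c ∸ (y + r)) +_) (m+[n∸m]≡n (m+n≤o⇒m≤o∸n y (subst (_≤ q) (+-comm b y) b+y≤q))) ⟩
        (c ∸ (y + r)) + (q ∸ b)              ∎
        where
        shuffle : ∀ a b c → a + (b + c) ≡ c + (b + a)
        shuffle = solve-∀
      -- The pair is complete. As `b` is at most `3μ − θ`, the good `y` is worth at least `μ + θ`.
      -- Two goods no smaller than `y` remain in `A`, so it lacks at most `μ`, and at least `μ` was
      -- missing next to `b`.
      ... | inj₂ q≤b+y = begin
        (c ∸ (b + y)) + (c ∸ r)    ≡⟨ cong (_+ (c ∸ r)) (m≤n⇒m∸n≡0 (≤-trans c≤q q≤b+y)) ⟩
        c ∸ r                      ≤⟨ m≤n+o⇒m∸n≤o c r c≤r+μ ⟩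
        μ                          ≤⟨ m+n≤o⇒m≤o∸n μ μ+b≤q ⟩
        q ∸ b                      ≤⟨ m≤n+m (q ∸ b) _ ⟩
        (c ∸ (y + r)) + (q ∸ b)    ∎
        where
        c≤r+μ : c ≤ r + μ
        c≤r+μ = subst (_≤ r + μ) (≡.sym c≡) (linear _ _ θ (+-mono-≤ 2y≤r (+-mono-≤ (+-mono-≤ b≤ b≤) (+-mono-≤ q≤b+y′ q≤b+y′)))
          (identity μ θ y r b))
          where
          q≤b+y′ : 4 * μ ≤ b + y
          q≤b+y′ = subst (_≤ b + y) q≡ q≤b+y
          identity : ∀ μ θ y r b → 3 * μ + θ + (r + (3 * μ + 3 * μ + (b + y + (b + y)))) + θ
                   ≡ r + μ + (y + y + (b + θ + (b + θ) + (4 * μ + 4 * μ)))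
          identity = solve-∀
        μ+b≤q : μ + b ≤ q
        μ+b≤q = subst (μ + b ≤_) (≡.sym q≡) (linear (b + θ) (3 * μ) θ b≤ (identity μ b θ))
          where
          identity : ∀ μ b θ → μ + b + 3 * μ + θ ≡ 4 * μ + (b + θ)
          identity = solve-∀

    repair-any : ∀ A B → 2 < length A → length B < 2 → All (λ x → x + θ ≤ 3 * μ) B → Repair A B
    repair-any A []          lt _ _        = repair-empty A lt
    repair-any A (b ∷ [])    lt _ (h ∷ _)  = repair-single A b lt h
    repair-any A (_ ∷ _ ∷ _) lt (s≤s (s≤s ())) _

  private
    Pairing : List (List ℕ) → Set
    Pairing bs = ∃ λ ps → flatten ps ↭ concat bs × total (pairDeficit c) ps ≤ total ψ bs

    use-repair : ∀ {A B rest bs} → bs ↭ A ∷ B ∷ rest → (R : Repair A B) →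
                 Pairing (Repair.C R ∷ rest) → Pairing bs
    use-repair {A} {B} {rest} {bs} p (repair (x , y) C perm better) (ps , perm′ , le) =
      (x , y) ∷ ps ,
      trans (prep x (prep y perm′)) (trans (Perm.++⁺ʳ (concat rest) perm)
        (trans (↭-reflexive (++-assoc A B (concat rest))) (↭-sym (concat-↭ p)))) ,
      (begin
        (c ∸ (x + y)) + total (pairDeficit c) ps       ≤⟨ +-monoʳ-≤ _ le ⟩
        (c ∸ (x + y)) + (ψ C + total ψ rest)           ≡⟨ +-assoc (c ∸ (x + y)) (ψ C) _ ⟨
        (c ∸ (x + y)) + ψ C + total ψ rest             ≤⟨ +-monoˡ-≤ (total ψ rest) better ⟩
        ψ A + ψ B + total ψ rest                       ≡⟨ +-assoc (ψ A) _ _ ⟩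
        total ψ (A ∷ B ∷ rest)                         ≡⟨ total-↭ ψ p ⟨
        total ψ bs                                     ∎)
      where open ≤-Reasoning

  -- The bundles have two goods on average, so a bundle with fewer goods comes with one that has
  -- more, and conversely. Repairing the two splits off a pair; the remainder stays in the list,
  -- which is shorter by one bundle and again has average two.
  pair-up : ∀ n bs → length bs ≡ n → length (concat bs) ≡ n * 2 →
            All (λ x → x + θ ≤ 3 * μ) (concat bs) → Pairing bs
  pair-up zero [] _ _ _ = [] , refl , z≤n
  pair-up (suc n) ((x ∷ y ∷ []) ∷ bs) l len (_ ∷ _ ∷ small) with
    pair-up n bs (suc-injective l) (suc-injective (suc-injective len)) small
  ... | ps , p , le = (x , y) ∷ ps , prep x (prep y p) ,
    +-mono-≤ (≤-reflexive (cong (λ t → c ∸ (x + t)) (≡.sym (+-identityʳ y)))) le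
  pair-up (suc n) (X ∷ bs) l len small = unbalanced X bs l len small
    where
    finish : ∀ {bs A B rest} → length bs ≡ suc n → length (concat bs) ≡ suc n * 2 →
             All (λ x → x + θ ≤ 3 * μ) (concat bs) → bs ↭ A ∷ B ∷ rest →
             2 < length A → length B < 2 → Pairing bs
    finish {bs} {A} {B} {rest} l len small p A> B< =
      use-repair p R (pair-up n (C ∷ rest)
        (suc-injective (≡.trans (≡.sym (Perm.↭-length p)) l))
        (suc-injective (suc-injective (≡.trans (Perm.↭-length p′) len)))
        (All.tail (All.tail (Perm.All-resp-↭ (↭-sym p′) small))))
      where
      R : Repair A B
      R = repair-any A B A> B< (Allₚ.++⁻ˡ B (Allₚ.++⁻ʳ A (Perm.All-resp-↭ (concat-↭ p) small)))
      open Repair R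
      p′ : proj₁ pair ∷ proj₂ pair ∷ C ++ concat rest ↭ concat bs
      p′ = trans (Perm.++⁺ʳ (concat rest) perm)
        (trans (↭-reflexive (++-assoc A B (concat rest))) (↭-sym (concat-↭ p)))

    len′ : ∀ X bs → length (X ∷ bs) ≡ suc n → length (X ++ concat bs) ≡ suc n * 2 →
           length X + length (concat bs) ≡ 2 + length bs * 2
    len′ X bs l len = ≡.trans (≡.sym (length-++ X)) (≡.trans len (cong (_* 2) (≡.sym l)))

    unbalanced : ∀ X bs → length (X ∷ bs) ≡ suc n → length (concat (X ∷ bs)) ≡ suc n * 2 →
                 All (λ x → x + θ ≤ 3 * μ) (concat (X ∷ bs)) → Pairing (X ∷ bs)
    unbalanced X bs l len small with <-cmp (length X) 2
    unbalanced X bs l len small | tri< X<2 _ _ with extract-any (pigeonhole-> 2 bs (+-cancelˡ-< (length X) _ _ (begin-strict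
        length X + length bs * 2         <⟨ +-monoˡ-< _ X<2 ⟩
        2 + length bs * 2                ≡⟨ len′ X bs l len ⟨
        length X + length (concat bs)    ∎)))
      where open ≤-Reasoning
    ... | A , rest , A> , p = finish l len small (trans (prep X p) (swap X A refl)) A> X<2
    unbalanced X bs l len small | tri> _ _ X>2 with extract-any (pigeonhole-< 2 bs (+-cancelˡ-< (length X) _ _ (begin-strict
        length X + length (concat bs)    ≡⟨ len′ X bs l len ⟩
        2 + length bs * 2                <⟨ +-monoˡ-< _ X>2 ⟩
        length X + length bs * 2         ∎)))
      where open ≤-Reasoning
    ... | B , rest , B< , p = finish l len small (prep X p) X>2 B<
    unbalanced (x ∷ y ∷ []) bs l len (_ ∷ _ ∷ small) | tri≈ _ _ _ with
      pair-up n bs (suc-injective l) (suc-injective (suc-injective len)) small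
    ... | ps , p , le = (x , y) ∷ ps , prep x (prep y p) ,
      +-mono-≤ (≤-reflexive (cong (λ t → c ∸ (x + t)) (≡.sym (+-identityʳ y)))) le

  -- In the given partition the small goods of each bundle make up for what its large goods lack.
  -- Neither `pair-up` nor the passage to the outer pairs increases the total deficit.
  small-goods-suffice : ∀ {n large smalls ps} → FeasibleParts q n large smalls →
    length large ≡ n * 2 → All (λ x → x + θ ≤ 3 * μ) large → AllPairs _≥_ large → Outer large ps →
    total (pairDeficit c) ps ≤ sum smalls
  small-goods-suffice {n} {large} {smalls} {ps} (qs , l , big , top , rest) len bound desc o
    with pair-up n (map proj₁ qs) (≡.trans (length-map proj₁ qs) l)
           (≡.trans (Perm.↭-length top) len) (Perm.All-resp-↭ (↭-sym top) bound)
  ... | ps′ , p , le = begin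
    total (pairDeficit c) ps               ≤⟨ outer-minimal c ps′ o desc (trans p top) ⟩
    total (pairDeficit c) ps′              ≤⟨ le ⟩
    total (deficit q c) (map proj₁ qs)     ≤⟨ covered qs big ⟩
    sum (concat (map proj₂ qs))            ≡⟨ sum-↭ rest ⟩
    sum smalls                             ∎
    where
    open ≤-Reasoning
    covered : ∀ qs → All (λ (s , t) → q ≤ sum s + sum t) qs →
              total (deficit q c) (map proj₁ qs) ≤ sum (concat (map proj₂ qs))
    covered [] [] = z≤n
    covered ((s , t) ∷ qs) (h ∷ hs) = begin
      deficit q c s + total (deficit q c) (map proj₁ qs)    ≤⟨ +-mono-≤ (≤-trans (deficit≤ c≤q s) (m≤n+o⇒m∸n≤o q (sum s) h)) (covered qs hs) ⟩
      sum t + sum (concat (map proj₂ qs))                   ≡⟨ sum-++ t _ ⟨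
      sum (t ++ concat (map proj₂ qs))                      ∎

-- Identically ordered goods

-- An Iverson bracket times `x`; the value of a set of goods thus becomes a sum over all goods.
on : {X : Set} → Dec X → ℕ → ℕ
on (yes _) x = x
on (no _)  _ = 0

on-yes : ∀ {X : Set} (X? : Dec X) x → X → on X? x ≡ x
on-yes (yes _) _ _ = ≡.refl
on-yes (no ¬x) _ x = contradiction x ¬x

share : ∀ {n} {P : Set} → (Fin n → P → ℕ) → Fin n → List (P × Fin n) → ℕ
share v a = total (λ (p , o) → on (o Fin.≟ a) (v a p))

split-at : ∀ {A : Set} k (xs : List A) → k < length xs →
           ∃₂ λ ys z → ∃ λ zs → xs ≡ ys ++ z ∷ zs × length ys ≡ k
split-at zero    (x ∷ xs) _        = [] , x , xs , ≡.refl , ≡.refl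
split-at (suc k) (x ∷ xs) (s≤s lt) with split-at k xs lt
... | ys , z , zs , ≡.refl , l = x ∷ ys , z , zs , ≡.refl , cong suc l

module _ {n : ℕ} {P : Set} (μ : Fin n → ℕ) (v : Fin n → P → ℕ) (d : Fin n) where

  Allocation : List (Fin n) → List P → Set
  Allocation as ps = ∃ λ tp → map proj₁ tp ↭ ps × (∀ {a} → a ∈ as → 3 * μ a ≤ share v a tp)

  untag : ∀ (a : Fin n) (b : List P) → map proj₁ (map {B = P × Fin n} (_, a) b) ≡ b
  untag a []      = ≡.refl
  untag a (x ∷ b) = cong (x ∷_) (untag a b)

  -- No demand is left, so the default agent `d` takes the remaining goods.
  nobody : ∀ ps → Allocation [] ps
  nobody ps = map (_, d) ps , ↭-reflexive (untag d ps) , λ ()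

  give : ∀ {as a as′ ps} b {ps′} → as ↭ a ∷ as′ → ps ↭ b ++ ps′ → 3 * μ a ≤ total (v a) b →
         Allocation as′ ps′ → Allocation as ps
  give {as} {a} {as′} {ps} b {ps′} p q big (tp , r , ok) = tag ++ tp ,
    trans (↭-reflexive (≡.trans (map-++ proj₁ tag tp) (cong (_++ map proj₁ tp) (untag a b))))
      (trans (Perm.++⁺ˡ b r) (↭-sym q)) ,
    λ {a′} a′∈ → subst (3 * μ a′ ≤_) (≡.sym (total-++ _ tag tp)) (enough (Perm.∈-resp-↭ p a′∈))
    where
    tag : List (P × Fin n)
    tag = map (_, a) b
    own : ∀ b → total (v a) b ≡ share v a (map (_, a) b)
    own []      = ≡.refl
    own (x ∷ b) = cong₂ _+_ (≡.sym (on-yes (a Fin.≟ a) _ ≡.refl)) (own b)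
    enough : ∀ {a′} → a′ ∈ a ∷ as′ → 3 * μ a′ ≤ share v a′ tag + share v a′ tp
    enough (here ≡.refl) = m≤n⇒m≤n+o _ (≤-trans big (≤-reflexive (own b)))
    enough (there a′∈)   = m≤n⇒m≤o+n _ (ok a′∈)

  module _ (θ : Fin n → ℕ) where

    -- Goods are added until the bag satisfies somebody. Before the last one nobody was satisfied,
    -- and the last one is worth at most `θ a` to agent `a`; therefore no agent sees more than its
    -- own deficit being spent.
    fill : ∀ {as} a₀ → a₀ ∈ as → ∀ b ss →
      (∀ {a} → a ∈ as → 3 * μ a + θ a ∸ total (v a) b ≤ total (v a) ss) →
      (∀ {a} → a ∈ as → All (λ s → v a s ≤ θ a) ss) →
      ∃₂ λ a as′ → ∃₂ λ t ss′ → as ↭ a ∷ as′ × ss ≡ t ++ ss′ × 3 * μ a ≤ total (v a) (b ++ t) ×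
      (∀ {a} → a ∈ as → total (v a) t ≤ 3 * μ a + θ a ∸ total (v a) b)
    fill {as} a₀ a₀∈ b ss enough small with Any.any? (λ a → 3 * μ a ≤? total (v a) b) as
    ... | yes any with extract-any any
    ... | a , as′ , big , p =
      a , as′ , [] , ss , p , ≡.refl , subst (λ t → 3 * μ a ≤ total (v a) t) (≡.sym (++-identityʳ b)) big , λ _ → z≤n
    -- The small goods have run out, so by `enough` the bag is worth at least `3 * μ a₀ + θ a₀` to
    -- `a₀`, who would have taken it.
    fill {as} a₀ a₀∈ b [] enough small | no ¬any =
      contradiction (≤-trans (m≤m+n _ (θ a₀)) (m∸n≡0⇒m≤n (n≤0⇒n≡0 (enough a₀∈)))) (λ h → ¬any (lose a₀∈ h))
    fill {as} a₀ a₀∈ b (s ∷ ss) enough small | no ¬any with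
      fill a₀ a₀∈ (s ∷ b) ss
        (λ {a} a∈ → m≤n+o⇒m∸n≤o (3 * μ a + θ a) _
          (≤-trans (m∸n≤o⇒m≤n+o (3 * μ a + θ a) (total (v a) b) (enough a∈)) (≤-reflexive (shuffle (total (v a) b) (v a s) (total (v a) ss)))))
        (λ a∈ → All.tail (small a∈))
      where
      shuffle : ∀ x y z → x + (y + z) ≡ y + x + z
      shuffle = solve-∀
      m∸n≤o⇒m≤n+o : ∀ m n {o} → m ∸ n ≤ o → m ≤ n + o
      m∸n≤o⇒m≤n+o m n h = ≤-trans (m≤n+m∸n m n) (+-monoʳ-≤ n h)
    ... | a , as′ , t , ss′ , p , ≡.refl , big , bound = a , as′ , s ∷ t , ss′ , p , ≡.refl ,
      subst (3 * μ a ≤_) (total-↭ (v a) (↭-sym (Perm.shift s b t))) big ,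
      λ {a} a∈ → ≤-trans (+-monoʳ-≤ (v a s) (bound a∈)) (≤-reflexive (≡.trans
        (cong (v a s +_) (≡.trans (cong (3 * μ a + θ a ∸_) (+-comm (v a s) _)) (≡.sym (∸-+-assoc (3 * μ a + θ a) (total (v a) b) (v a s)))))
        (m+[n∸m]≡n (m+n≤o⇒m≤o∸n (v a s) (≤-trans (≤-reflexive (+-comm (v a s) _))
          (+-mono-≤ (<⇒≤ (≰⇒> (λ h → ¬any (lose a∈ h)))) (All.head (small a∈))))))))

    -- Invariant: in the eyes of every remaining agent, the small goods cover the total deficit of
    -- the remaining bags. Filling a bag costs at most that bag's own deficit, so the invariant
    -- passes on to the other bags.
    fill-bags : ∀ bags {as} ss → length as ≡ length bags →
      (∀ {a} → a ∈ as → total (λ (x , y) → 3 * μ a + θ a ∸ (v a x + v a y)) bags ≤ total (v a) ss) →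
      (∀ {a} → a ∈ as → All (λ s → v a s ≤ θ a) ss) →
      Allocation as (flatten bags ++ ss)
    fill-bags [] {[]} ss _ _ _ = nobody ss
    fill-bags ((x , y) ∷ bags) {a₀ ∷ as₀} ss len enough small with
      fill a₀ (here ≡.refl) (x ∷ y ∷ []) ss
        (λ {a} a∈ → ≤-trans (≤-reflexive (two a)) (≤-trans (m≤m+n _ _) (enough a∈))) small
      where
      two : ∀ a → 3 * μ a + θ a ∸ total (v a) (x ∷ y ∷ []) ≡ 3 * μ a + θ a ∸ (v a x + v a y)
      two a = cong (λ t → 3 * μ a + θ a ∸ (v a x + t)) (+-identityʳ (v a y))
    ... | a , as′ , t , ss′ , p , ≡.refl , big , bound =
      give (x ∷ y ∷ t) p perm big
        (fill-bags bags ss′ (suc-injective (≡.trans (≡.sym (Perm.↭-length p)) len))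
          (λ {a′} a′∈ → let a∈ = Perm.∈-resp-↭ (↭-sym p) (there a′∈) in
            +-cancelˡ-≤ (3 * μ a′ + θ a′ ∸ (v a′ x + v a′ y)) _ _
              (≤-trans (enough a∈) (≤-trans (≤-reflexive (total-++ (v a′) t ss′))
                (+-monoˡ-≤ _ (≤-trans (bound a∈) (≤-reflexive (cong (λ t → 3 * μ a′ + θ a′ ∸ (v a′ x + t)) (+-identityʳ (v a′ y)))))))))
          (λ a′∈ → Allₚ.++⁻ʳ t (small (Perm.∈-resp-↭ (↭-sym p) (there a′∈)))))
      where
      perm : x ∷ y ∷ flatten bags ++ (t ++ ss′) ↭ (x ∷ y ∷ t) ++ (flatten bags ++ ss′)
      perm = prep x (prep y (Perm.shifts (flatten bags) t))

  -- Induction on the number n = `suc m` of agents. `p₁` is the best good, and `r₁`, `r₂`, `q` stand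
  -- at positions 2n-1, 2n, 2n+1. A reduction uses up at most three goods and one agent, so the
  -- bound `m * 3` persists, and it guarantees that position 2n+1 exists.
  ordered : ∀ m {as} ps → length as ≡ m → m * 3 < length ps →
            AllPairs (λ p q → ∀ a → v a q ≤ v a p) ps →
            (∀ {a} → a ∈ as → Feasible (4 * μ a) m (map (v a) ps)) → Allocation as ps
  ordered zero {[]} ps _ _ _ _ = nobody ps
  ordered (suc m) {as} ps l long sorted F with split-at (m * 2) ps (≤-<-trans (*-monoʳ-≤ m (s≤s (s≤s z≤n))) (≤-<-trans (m≤n+m _ 3) long))
  ... | init , r₁ , tl , ≡.refl , li = view tl (+-cancelˡ-< (m * 2) _ _ (≤-<-trans (≤-trans (m≤m+n _ m) (≤-reflexive (count m))) (<-≤-trans long (≤-reflexive (≡.trans (length-++ init) (cong (_+ _) li)))))) sorted long F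
    where
    count : ∀ m → m * 2 + 3 + m ≡ suc m * 3
    count = solve-∀
    view : ∀ tl → 3 < length (r₁ ∷ tl) → AllPairs (λ p q → ∀ a → v a q ≤ v a p) (init ++ r₁ ∷ tl) →
           suc m * 3 < length (init ++ r₁ ∷ tl) →
           (∀ {a} → a ∈ as → Feasible (4 * μ a) (suc m) (map (v a) (init ++ r₁ ∷ tl))) → Allocation as (init ++ r₁ ∷ tl)
    view (_ ∷ []) (s≤s (s≤s ()))
    view (r₂ ∷ q ∷ rest) _ sorted long F = first (first-view init)
      where
      large = init ++ r₁ ∷ r₂ ∷ []
      ps₀ = init ++ r₁ ∷ r₂ ∷ q ∷ rest

      first-view : ∀ xs {x y : P} → ∃₂ λ p ms → xs ++ x ∷ y ∷ [] ≡ p ∷ ms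
      first-view []       = _ , _ , ≡.refl
      first-view (x ∷ xs) = _ , _ , ≡.refl

      ps≡ : ps₀ ≡ large ++ q ∷ rest
      ps≡ = ≡.sym (++-assoc init (r₁ ∷ r₂ ∷ []) (q ∷ rest))

      large-length : length large ≡ suc m * 2
      large-length = ≡.trans (length-++ init) (≡.trans (+-comm _ 2) (cong (2 +_) li))

      sorted′ : AllPairs (λ p q → ∀ a → v a q ≤ v a p) (large ++ q ∷ rest)
      sorted′ = subst (AllPairs _) ps≡ sorted

      shorter : ∀ {k} (xs : List P) → k + length xs ≡ length ps₀ → k ≤ 3 → m * 3 < length xs
      shorter {k} xs eq k≤3 = +-cancelˡ-< k _ _ (≤-<-trans (+-monoˡ-≤ _ k≤3) (<-≤-trans long (≤-reflexive (≡.sym eq))))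

      fewer : ∀ {a as′} → as ↭ a ∷ as′ → length as′ ≡ m
      fewer p = suc-injective (≡.trans (≡.sym (Perm.↭-length p)) l)

      first : (∃₂ λ p ms → large ≡ p ∷ ms) → Allocation as ps₀
      first (p₁ , mid , large≡) with Any.any? (λ a → 3 * μ a ≤? v a p₁) as
      ... | yes any with extract-any any
      ... | a , as′ , big , p = give [ p₁ ] p (↭-reflexive ps≡′) (≤-trans big (≤-reflexive (≡.sym (+-identityʳ _))))
        (ordered m (mid ++ q ∷ rest) (fewer p) (shorter {1} (mid ++ q ∷ rest) (≡.sym (cong length ps≡′)) (s≤s z≤n))
          (AllPairs.tail (subst (AllPairs _) ps≡′ sorted))
          (λ {a′} a′∈ → Feasible-∷ (subst (λ t → Feasible (4 * μ a′) (suc m) (map (v a′) t)) ps≡′ (F (Perm.∈-resp-↭ (↭-sym p) (there a′∈))))))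
        where
        ps≡′ : ps₀ ≡ p₁ ∷ (mid ++ q ∷ rest)
        ps≡′ = ≡.trans ps≡ (cong (_++ q ∷ rest) large≡)
      -- The triple is given away if its smallest good is worth `μ a` to somebody. If this fails,
      -- `θ a`, the value of `q`, is less than `μ a` for all agents.
      first (p₁ , mid , large≡) | no no₁ with Any.any? (λ a → μ a ≤? v a q) as
      ... | yes any with extract-any any
      ... | a , as′ , big , p = give (r₁ ∷ r₂ ∷ q ∷ []) p (Perm.shifts init (r₁ ∷ r₂ ∷ q ∷ []))
        (begin
          3 * μ a                            ≤⟨ *-monoʳ-≤ 3 big ⟩
          v a q + (v a q + (v a q + 0))      ≤⟨ +-mono-≤ q≤r₁ (+-monoˡ-≤ _ q≤r₂) ⟩
          v a r₁ + (v a r₂ + (v a q + 0))    ∎)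
        (ordered m (init ++ rest) (fewer p) (shorter {3} (init ++ rest) (≡.sym (Perm.↭-length (Perm.shifts init (r₁ ∷ r₂ ∷ q ∷ [])))) ≤-refl)
          (AllPairs-delete init (AllPairs-delete init (AllPairs-delete init sorted)))
          (λ {a′} a′∈ → reduced a′ (F (Perm.∈-resp-↭ (↭-sym p) (there a′∈)))))
        where
        open ≤-Reasoning
        crosses : ∀ xs {ys : List P} → AllPairs (λ p q → ∀ a → v a q ≤ v a p) (xs ++ ys) → All (λ y → All (λ x → ∀ a → v a y ≤ v a x) xs) ys
        crosses [] s = All.universal (λ _ → []) _
        crosses (x ∷ xs) (h ∷ s) = All.zipWith (λ (a , b) → a ∷ b) (Allₚ.++⁻ʳ xs h , crosses xs s)
        q≤r₁ : v a q ≤ v a r₁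
        q≤r₁ with AllPairs-++⁻ʳ init sorted
        ... | (_ ∷ h ∷ _) ∷ _ = h a
        q≤r₂ : v a q ≤ v a r₂
        q≤r₂ with AllPairs-++⁻ʳ init sorted
        ... | _ ∷ (h ∷ _) ∷ _ = h a
        -- Some bundle holds three of the first 2n+1 goods. After it is dissolved, the three lost
        -- goods are exchanged for the three smallest of these 2n+1.
        reduced : ∀ a → Feasible (4 * μ a) (suc m) (map (v a) ps₀) → Feasible (4 * μ a) m (map (v a) (init ++ rest))
        reduced a Fa with Feasible-triple (map (v a) top) (map (v a) rest) top-length
                 (subst (Feasible (4 * μ a) (suc m)) (≡.trans (cong (map (v a)) (≡.sym (++-assoc init (r₁ ∷ r₂ ∷ q ∷ []) rest))) (map-++ (v a) top rest)) Fa)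
          where
          top = init ++ r₁ ∷ r₂ ∷ q ∷ []
          top-length : suc m * 2 < length (map (v a) top)
          top-length = ≤-reflexive (≡.sym (≡.trans (length-map (v a) top) (≡.trans (length-++ init) (≡.trans (+-comm _ 3) (cong (3 +_) li)))))
        ... | ks , os , kl , tp , F′ = subst (Feasible (4 * μ a) m) (≡.sym (map-++ (v a) init rest))
          (Feasible-swap ks (map (v a) (r₁ ∷ r₂ ∷ q ∷ [])) kl
            (trans (↭-sym tp) (trans (↭-reflexive (map-++ (v a) init _)) (Perm.++-comm (map (v a) init) _)))
            (AllPairsₚ.map⁺ {R = _≥_} (AllPairs.map (λ h → h a) ls-sorted))
            (Allₚ.map⁺ {f = v a} (All.map (λ h → Allₚ.map⁺ (All.map (λ h′ → h′ a) h)) ls-low)) F′)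
          where
          ls-sorted : AllPairs (λ p q → ∀ a → v a q ≤ v a p) (r₁ ∷ r₂ ∷ q ∷ [])
          ls-sorted with AllPairs-++⁻ʳ init sorted
          ... | (h₁ ∷ h₂ ∷ _) ∷ (h₃ ∷ _) ∷ _ = (h₁ ∷ h₂ ∷ []) ∷ (h₃ ∷ []) ∷ [] ∷ []
          ls-low : All (λ y → All (λ x → ∀ a → v a y ≤ v a x) init) (r₁ ∷ r₂ ∷ q ∷ [])
          ls-low with crosses init sorted
          ... | h₁ ∷ h₂ ∷ h₃ ∷ _ = h₁ ∷ h₂ ∷ h₃ ∷ []
      first (p₁ , mid , large≡) | no no₁ | no no₃ with Any.any? (λ a → 3 * μ a ≤? v a p₁ + v a q) as
      ... | yes any with extract-any any
      ... | a , as′ , big , p = give (p₁ ∷ q ∷ []) p perm (≤-trans big (≤-reflexive (cong (v a p₁ +_) (≡.sym (+-identityʳ _)))))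
        (ordered m (mid ++ rest) (fewer p) (shorter {2} (mid ++ rest) (≡.sym (Perm.↭-length perm)) (s≤s (s≤s z≤n)))
          (AllPairs.tail (AllPairs-delete (p₁ ∷ mid) (subst (λ t → AllPairs _ (t ++ q ∷ rest)) large≡ sorted′)))
          (λ {a′} a′∈ → let a∈ = Perm.∈-resp-↭ (↭-sym p) (there a′∈) in
            -- The two failed tests give `p₁` less than `3 * μ a′` and `q` less than `μ a′`, hence
            -- at most `4 * μ a′` together.
            Feasible-∷∷ (linear _ _ 0 (+-mono-≤ (<⇒≤ (≰⇒> (λ h → no₁ (lose a∈ h)))) (<⇒≤ (≰⇒> (λ h → no₃ (lose a∈ h)))))
               (identity (μ a′) (v a′ p₁) (v a′ q)))
             (Feasible-↭ (Perm.map⁺ (v a′) perm) (F a∈))))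
        where
        identity : ∀ μ x y → x + y + (3 * μ + μ) + 0 ≡ 4 * μ + (x + y)
        identity = solve-∀
        perm : ps₀ ↭ p₁ ∷ q ∷ (mid ++ rest)
        perm = trans (↭-reflexive (≡.trans ps≡ (cong (_++ q ∷ rest) large≡))) (prep p₁ (Perm.shift q mid rest))
      -- No reduction applies. The failed tests supply what `small-goods-suffice` asks for: `θ a` is
      -- at most `μ a`, and every large good, being at most `p₁`, is worth at most `3 * μ a − θ a`.
      first (p₁ , mid , large≡) | no no₁ | no no₃ | no no₂ with outer-pairs (suc m) large large-length
      ... | bags , o , bl =
        let tp , perm , ok = fill-bags θ bags (q ∷ rest) (≡.trans l (≡.sym bl)) enough small in
        tp , trans perm (trans (Perm.++⁺ʳ (q ∷ rest) (Outer-↭ o)) (↭-reflexive (≡.sym ps≡))) , ok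
        where
        open ≤-Reasoning
        θ : Fin n → ℕ
        θ a = v a q
        small : ∀ {a} → a ∈ as → All (λ s → v a s ≤ θ a) (q ∷ rest)
        small {a} _ with AllPairs-++⁻ʳ large sorted′
        ... | h ∷ _ = ≤-refl ∷ All.map (λ h → h a) h
        enough : ∀ {a} → a ∈ as → total (λ (x , y) → 3 * μ a + θ a ∸ (v a x + v a y)) bags ≤ total (v a) (q ∷ rest)
        enough {a} a∈ = begin
          total (λ (x , y) → c ∸ (v a x + v a y)) bags                  ≡⟨ cong sum (map-∘ bags) ⟩
          total (pairDeficit c) (map (λ (x , y) → v a x , v a y) bags)  ≤⟨ suffices ⟩
          total (v a) (q ∷ rest)                                        ∎
          where
          c = 3 * μ a + θ a
          bounded : All (λ x → v a x + θ a ≤ 3 * μ a) large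
          bounded = subst (All _) (≡.sym large≡) (p₁-bound ∷ All.map (λ h → ≤-trans (+-monoˡ-≤ (θ a) (h a)) p₁-bound) mid-low)
            where
            p₁-bound : v a p₁ + θ a ≤ 3 * μ a
            p₁-bound = <⇒≤ (≰⇒> (λ h → no₂ (lose a∈ h)))
            mid-low : All (λ x → ∀ a → v a x ≤ v a p₁) mid
            mid-low = Allₚ.++⁻ˡ mid (AllPairs.head (subst (λ t → AllPairs _ (t ++ q ∷ rest)) large≡ sorted′))
          suffices : total (pairDeficit c) (map (λ (x , y) → v a x , v a y) bags) ≤ total (v a) (q ∷ rest)
          suffices = small-goods-suffice (μ a) (θ a) (4 * μ a) c ≡.refl ≡.refl (<⇒≤ (≰⇒> (λ h → no₃ (lose a∈ h))))
            (parts (map (v a) large) (map (v a) (q ∷ rest))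
              (subst (Feasible (4 * μ a) (suc m)) (≡.trans (cong (map (v a)) ps≡) (map-++ (v a) large (q ∷ rest))) (F a∈)))
            (≡.trans (length-map (v a) large) large-length)
            (Allₚ.map⁺ bounded)
            (AllPairsₚ.map⁺ {R = _≥_} (AllPairs.map (λ h → h a) (AllPairs-++⁻ˡ large sorted′)))
            (Outer-map (v a) o)

-- Complete graphs

total-mono : ∀ {A : Set} {f g : A → ℕ} {xs} → All (λ x → f x ≤ g x) xs → total f xs ≤ total g xs
total-mono []       = z≤n
total-mono (h ∷ hs) = +-mono-≤ h (total-mono hs)

insert-by : ∀ {A : Set} (f : A → ℕ) x {ys} → AllPairs (λ x y → f y ≤ f x) ys →
            ∃ λ zs → zs ↭ x ∷ ys × AllPairs (λ x y → f y ≤ f x) zs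
insert-by f x [] = [ x ] , refl , [] ∷ []
insert-by f x {y ∷ ys} (h ∷ s) with ≤-total (f y) (f x)
... | inj₁ y≤x = x ∷ y ∷ ys , refl , (y≤x ∷ All.map (λ z≤y → ≤-trans z≤y y≤x) h) ∷ h ∷ s
... | inj₂ x≤y with insert-by f x s
... | zs , p , s′ = y ∷ zs , trans (prep y p) (swap y x refl) , Perm.All-resp-↭ (↭-sym p) (x≤y ∷ h) ∷ s′

sort-by : ∀ {A : Set} (f : A → ℕ) xs → ∃ λ ys → ys ↭ xs × AllPairs (λ x y → f y ≤ f x) ys
sort-by f [] = [] , refl , []
sort-by f (x ∷ xs) with sort-by f xs
... | ys , p , s with insert-by f x s
... | zs , q , s′ = zs , trans q (prep x p) , s′

module _ {n : ℕ} {P G : Set} (v : Fin n → P → ℕ) (W : Fin n → G → ℕ) where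

  private
    Above : Fin n → List P → List G → Set
    Above a = Pointwise (λ p x → v a p ≤ W a x)

  -- The goods ranked before `x` are now compared with the next position, which is worth no more;
  -- those ranked after `x` keep theirs.
  Above-remove : ∀ {a p ps} pre {x post} → AllPairs (λ p q → ∀ a → v a q ≤ v a p) (p ∷ ps) →
                 Above a (p ∷ ps) (pre ++ x ∷ post) → Above a ps (pre ++ post)
  Above-remove []        _ (_ ∷ pw) = pw
  Above-remove {a} {ps = p′ ∷ ps} (y ∷ pre) ((h ∷ _) ∷ s) (p≤y ∷ pw) =
    ≤-trans (h a) p≤y ∷ Above-remove pre s pw
  Above-remove {ps = []} (y ∷ []) _ (_ ∷ ())
  Above-remove {ps = []} (y ∷ _ ∷ _) _ (_ ∷ ())

  -- Every agent in turn takes the best remaining good: the good at position p of its own ranking,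
  -- or a better one, is still there when p goods have been taken.
  picking-sequence : Fin n → ∀ (tp : List (P × Fin n)) rem →
    AllPairs (λ p q → ∀ a → v a q ≤ v a p) (map proj₁ tp) →
    (∀ a → ∃ λ pref → pref ↭ rem × Above a (map proj₁ tp) pref) →
    ∃ λ tg → map proj₁ tg ↭ rem × (∀ a → share v a tp ≤ share W a tg)
  picking-sequence d [] rem _ prefs with prefs d
  ... | [] , p , _ = [] , p , λ _ → z≤n
  picking-sequence d ((p , o) ∷ tp) rem (h ∷ s) prefs with prefs o
  ... | x ∷ rem′ , xp , o≤ ∷ o-above with picking-sequence d tp rem′ s prefs′
    where
    prefs′ : ∀ a → ∃ λ pref → pref ↭ rem′ × Above a (map proj₁ tp) pref
    prefs′ a with prefs a
    ... | pref , q , above with ∈-∃++ (Perm.∈-resp-↭ (trans xp (↭-sym q)) (here ≡.refl))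
    ... | pre , post , ≡.refl = pre ++ post ,
      Perm.drop-∷ (trans (↭-sym (Perm.shift x pre post)) (trans q (↭-sym xp))) ,
      Above-remove pre (h ∷ s) above
  ... | tg , r , ok = (x , o) ∷ tg , trans (prep x r) xp , λ a → +-mono-≤ (taken a) (ok a)
    where
    taken : ∀ a → on (o Fin.≟ a) (v a p) ≤ on (o Fin.≟ a) (W a x)
    taken a with o Fin.≟ a
    ... | yes ≡.refl = o≤
    ... | no _       = z≤n

nth : ∀ {A : Set} → A → List A → ℕ → A
nth d []       _       = d
nth d (x ∷ xs) zero    = x
nth d (x ∷ xs) (suc i) = nth d xs i

map-nth : ∀ {A : Set} (d : A) xs → map (nth d xs) (upTo (length xs)) ≡ xs
map-nth d xs = ≡.trans (map-upTo (nth d xs) (length xs)) (go xs)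
  where
  go : ∀ xs → applyUpTo (nth d xs) (length xs) ≡ xs
  go []       = ≡.refl
  go (x ∷ xs) = cong (x ∷_) (go xs)

AllPairs-nth : ∀ {A : Set} {R : A → A → Set} d {xs} → AllPairs R xs →
               ∀ {i j} → i < j → j < length xs → R (nth d xs i) (nth d xs j)
AllPairs-nth d (h ∷ s) {zero}  {suc j} _         (s≤s j<) = All-nth h j<
  where
  All-nth : ∀ {A : Set} {Q : A → Set} {d xs} → All Q xs → ∀ {j} → j < length xs → Q (nth d xs j)
  All-nth (h ∷ _)  {zero}  _        = h
  All-nth (_ ∷ hs) {suc j} (s≤s j<) = All-nth hs j<
AllPairs-nth d (h ∷ s) {suc i} {suc j} (s≤s i<j) (s≤s j<) = AllPairs-nth d s i<j j<

Feasible-++ : ∀ {q n xs} ys → Feasible q n xs → Feasible q n (xs ++ ys)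
Feasible-++ ys (bs , junk , l , big , p) =
  bs , junk ++ ys , l , big , trans (↭-reflexive (≡.sym (++-assoc (concat bs) junk ys))) (Perm.++⁺ʳ ys p)

module _ {g n : ℕ} (W : Fin n → Fin g → ℕ) where

  private
    -- Worthless dummy goods make the list of goods long enough for the reductions.
    W′ : Fin n → Maybe (Fin g) → ℕ
    W′ a nothing  = 0
    W′ a (just x) = W a x

  owner : Fin n → ∀ N xs (tg : List (Maybe (Fin g) × Fin n)) → Unique xs →
          map proj₁ tg ↭ map just xs ++ replicate N nothing →
          ∃ λ (own : Fin g → Fin n) → ∀ a → share W′ a tg ≤ total (λ x → on (own x Fin.≟ a) (W a x)) xs
  owner d N [] tg _ p = (λ _ → d) , λ a → ≤-reflexive (worthless tg a (Perm.All-resp-↭ (↭-sym p) (Allₚ.replicate⁺ N ≡.refl)))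
    where
    worthless : ∀ tg a → All (_≡ nothing) (map proj₁ tg) → share W′ a tg ≡ 0
    worthless [] a _ = ≡.refl
    worthless ((nothing , o) ∷ tg) a (_ ∷ h) with o Fin.≟ a
    ... | yes _ = worthless tg a h
    ... | no _  = worthless tg a h
  owner d N (x ∷ xs) tg (x∉ ∷ u) p with ∈-map⁻ proj₁ (Perm.∈-resp-↭ (↭-sym p) (here ≡.refl))
  ... | (just x , o) , e∈ , ≡.refl with extract e∈
  ... | tg′ , q with owner d N xs tg′ u (Perm.drop-∷ (trans (↭-sym (Perm.map⁺ proj₁ q)) p))
  ... | own , ok = own′ , λ a → ≤-trans (≤-reflexive (total-↭ _ q))
      (+-mono-≤ (≤-reflexive (same a)) (≤-trans (ok a) (total-mono (All.map (λ {y} → other a y) x∉))))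
    where
    own′ : Fin g → Fin n
    own′ y with y Fin.≟ x
    ... | yes _ = o
    ... | no _  = own y
    same : ∀ a → on (o Fin.≟ a) (W a x) ≡ on (own′ x Fin.≟ a) (W a x)
    same a with x Fin.≟ x
    ... | yes _  = ≡.refl
    ... | no x≢x = contradiction ≡.refl x≢x
    other : ∀ a y → x ≢ y → on (own y Fin.≟ a) (W a y) ≤ on (own′ y Fin.≟ a) (W a y)
    other a y x≢y with y Fin.≟ x
    ... | yes y≡x = contradiction (≡.sym y≡x) x≢y
    ... | no _    = ≤-refl

  -- The ordered instance has positions as goods: position `p` is worth to agent `a` what the good
  -- at place `p` of its own ranking is worth. Each agent sees the same multiset of values as
  -- before, so feasibility persists, and `picking-sequence` turns positions back into goods.
  complete-graph : (μ : Fin n → ℕ) (d : Fin n) (as : List (Fin n)) →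
    (∀ {a} → a ∈ as → Feasible (4 * μ a) (length as) (map (W a) (allFin g))) →
    ∃ λ (own : Fin g → Fin n) → ∀ {a} → a ∈ as → 3 * μ a ≤ total (λ x → on (own x Fin.≟ a) (W a x)) (allFin g)
  complete-graph μ d as F =
    let tp , p , ok      = ordered μ v d (length as) positions ≡.refl long sorted F′
        ps′ , eq , q     = Perm.↭-map-inv proj₁ p
        tg , r , better  = picking-sequence v W′ d ps′ gs (subst (AllPairs _) eq sorted) (λ a → pref a , pref-↭ a , subst (λ ps → Pointwise (λ p x → v a p ≤ W′ a x) ps (pref a)) eq (above a))
        own , fine       = owner d N (allFin g) tg (allFin⁺ g) r
    in own , λ {a} a∈ → ≤-trans (ok a∈) (≤-trans (≤-reflexive (total-↭ _ q)) (≤-trans (better a) (fine a)))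
    where
    -- The dummies alone satisfy the length condition of `ordered`.
    N = suc (length as * 3)
    gs : List (Maybe (Fin g))
    gs = map just (allFin g) ++ replicate N nothing
    pref : Fin n → List (Maybe (Fin g))
    pref a = proj₁ (sort-by (W′ a) gs)
    pref-↭ : ∀ a → pref a ↭ gs
    pref-↭ a = proj₁ (proj₂ (sort-by (W′ a) gs))
    positions : List ℕ
    positions = upTo (length gs)
    v : Fin n → ℕ → ℕ
    v a p = W′ a (nth nothing (pref a) p)
    gs-long : length as * 3 < length gs
    gs-long = subst (length as * 3 <_) (≡.sym (length-++ (map just (allFin g))))
      (m≤n⇒m≤o+n _ (≤-reflexive (≡.sym (length-replicate N))))
    long : length as * 3 < length positions
    long = subst (length as * 3 <_) (≡.sym (length-upTo (length gs))) gs-long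
    sorted : AllPairs (λ p q → ∀ a → v a q ≤ v a p) positions
    sorted = AllPairsₚ.applyUpTo⁺₁ id (length gs) (λ i<j j< a →
      AllPairs-nth nothing (proj₂ (proj₂ (sort-by (W′ a) gs))) i<j (subst (_ <_) (≡.sym (Perm.↭-length (pref-↭ a))) j<))
    nth-positions : ∀ a → map (nth nothing (pref a)) positions ≡ pref a
    nth-positions a = subst (λ k → map (nth nothing (pref a)) (upTo k) ≡ pref a) (Perm.↭-length (pref-↭ a)) (map-nth nothing (pref a))
    F′ : ∀ {a} → a ∈ as → Feasible (4 * μ a) (length as) (map (v a) positions)
    F′ {a} a∈ = Feasible-↭ perm (Feasible-++ (map (W′ a) (replicate N nothing)) (F a∈))
      where
      perm : map (W a) (allFin g) ++ map (W′ a) (replicate N nothing) ↭ map (v a) positions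
      perm = trans (↭-reflexive (≡.trans (cong (_++ map (W′ a) (replicate N nothing)) (map-∘ (allFin g))) (≡.sym (map-++ (W′ a) (map just (allFin g)) _))))
        (trans (↭-sym (Perm.map⁺ (W′ a) (pref-↭ a)))
          (↭-reflexive (≡.trans (cong (map (W′ a)) (≡.sym (nth-positions a))) (≡.sym (map-∘ positions)))))
    above : ∀ a → Pointwise (λ p x → v a p ≤ W′ a x) positions (pref a)
    above a = subst (Pointwise _ positions) (nth-positions a) (go positions)
      where
      go : ∀ ps → Pointwise (λ p x → v a p ≤ W′ a x) ps (map (nth nothing (pref a)) ps)
      go []       = []
      go (p ∷ ps) = ≤-refl ∷ go ps

-- Merging the attachments of 2 ^ k types

on-no : ∀ {X : Set} (X? : Dec X) x → ¬ X → on X? x ≡ 0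
on-no (yes x) _ ¬x = contradiction x ¬x
on-no (no _)  _ _  = ≡.refl

on-mono : ∀ {X Y : Set} (X? : Dec X) (Y? : Dec Y) {x y} → (X → Y × x ≤ y) → on X? x ≤ on Y? y
on-mono (yes x) Y? f = subst (_ ≤_) (≡.sym (on-yes Y? _ (proj₁ (f x)))) (proj₂ (f x))
on-mono (no _)  Y? _ = z≤n

Unique-↭ : ∀ {A : Set} {xs ys : List A} → xs ↭ ys → Unique xs → Unique ys
Unique-↭ refl u = u
Unique-↭ (prep x p) (h ∷ u) = Perm.All-resp-↭ p h ∷ Unique-↭ p u
Unique-↭ (swap x y p) ((x≢y ∷ hx) ∷ hy ∷ u) =
  (≢-sym x≢y ∷ Perm.All-resp-↭ p hy) ∷ Perm.All-resp-↭ p hx ∷ Unique-↭ p u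
Unique-↭ (trans p q) u = Unique-↭ q (Unique-↭ p u)

All≢⇒∉ : ∀ {A : Set} {x : A} {xs} → All (x ≢_) xs → x ∉ xs
All≢⇒∉ h x∈ = All.lookup h x∈ ≡.refl

module _ {V : Set} (_≟_ : DecidableEquality V) where

  open DecMembership _≟_ using (_∈?_)

  Separates : (V → Bool) → V × V → Set
  Separates χ (x , y) = χ y ≡ not (χ x)

  Separates-sym : ∀ χ {x y} → Separates χ (x , y) → Separates χ (y , x)
  Separates-sym χ {x} eq = ≡.trans (≡.sym (Boolₚ.not-involutive (χ x))) (cong not (≡.sym eq))

  private
    record Recolour (χ : V → Bool) (u w : V) (b : Bool) : Set where
      constructor recoloured
      field
        χ′    : V → Bool
        at-u  : χ′ u ≡ b
        at-w  : χ′ w ≡ not b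
        fixes : ∀ {x} → u ≢ x → w ≢ x → χ′ x ≡ χ x

      keeps : ∀ M → u ∉ flatten M → w ∉ flatten M → All (Separates χ) M → All (Separates χ′) M
      keeps [] _ _ [] = []
      keeps ((x , y) ∷ M) u∉ w∉ (s ∷ ss) =
        ≡.trans (fixes (λ e → u∉ (there (here e))) (λ e → w∉ (there (here e))))
          (≡.trans s (cong not (≡.sym (fixes (λ e → u∉ (here e)) (λ e → w∉ (here e)))))) ∷
        keeps M (λ h → u∉ (there (there h))) (λ h → w∉ (there (there h))) ss

    recolour : ∀ χ {u w} b → u ≢ w → Recolour χ u w b
    recolour χ {u} {w} b u≢w = recoloured χ′ at-u at-w fixes
      where
      χ′ : V → Bool
      χ′ x with u ≟ x | w ≟ x
      ... | yes _ | _     = b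
      ... | no _  | yes _ = not b
      ... | no _  | no _  = χ x
      at-u : χ′ u ≡ b
      at-u with u ≟ u | w ≟ u
      ... | yes _  | _ = ≡.refl
      ... | no u≢u | _ = contradiction ≡.refl u≢u
      at-w : χ′ w ≡ not b
      at-w with u ≟ w | w ≟ w
      ... | yes e | _      = contradiction e u≢w
      ... | no _  | yes _  = ≡.refl
      ... | no _  | no w≢w = contradiction ≡.refl w≢w
      fixes : ∀ {x} → u ≢ x → w ≢ x → χ′ x ≡ χ x
      fixes {x} u≢x w≢x with u ≟ x | w ≟ x
      ... | yes e | _     = contradiction e u≢x
      ... | no _  | yes e = contradiction e w≢x
      ... | no _  | no _  = ≡.refl

    Extracted : List (V × V) → V → V → List (V × V) → Set
    Extracted M x y M′ = M ↭ (x , y) ∷ M′ ⊎ M ↭ (y , x) ∷ M′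

    separated : ∀ χ {M x y M′} → Extracted M x y M′ → Separates χ (x , y) →
                All (Separates χ) M′ → All (Separates χ) M
    separated χ (inj₁ p) s ss = Perm.All-resp-↭ (↭-sym p) (s ∷ ss)
    separated χ (inj₂ p) s ss = Perm.All-resp-↭ (↭-sym p) (Separates-sym χ s ∷ ss)

    partner : ∀ {x} M → x ∈ flatten M → ∃₂ λ y M′ → Extracted M x y M′ × flatten M ↭ x ∷ y ∷ flatten M′
    partner {x} M x∈ with extract x∈
    ... | xs , p with locate-pair M p
    ... | y , M′ , e , q = y , M′ , e , trans p (prep x (↭-sym q))

  -- The union of two matchings is bipartite.  An edge (u , w) of the first matching is contracted
  -- to an edge between the partners of u and w in the second matching.
  two-colouring : ∀ M N → Unique (flatten M) → Unique (flatten N) →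
                  ∃ λ χ → All (Separates χ) M × All (Separates χ) N
  two-colouring [] [] _ _ = (λ _ → true) , [] , []
  two-colouring [] ((x , y) ∷ N) _ ((x≢y ∷ x∉) ∷ y∉ ∷ u) with two-colouring [] N [] u
  ... | χ , _ , sN = χ′ , [] , ≡.trans at-w (cong not (≡.sym at-u)) ∷ keeps N (All≢⇒∉ x∉) (All≢⇒∉ y∉) sN
    where open Recolour (recolour χ true x≢y)
  two-colouring ((u , w) ∷ M) N ((u≢w ∷ u∉M) ∷ w∉M ∷ uM) uN with u ∈? flatten N
  two-colouring ((u , w) ∷ M) N ((u≢w ∷ u∉M) ∷ w∉M ∷ uM) uN | no u∉N with w ∈? flatten N
  ... | no w∉N with two-colouring M N uM uN
  ... | χ , sM , sN = χ′ , ≡.trans at-w (cong not (≡.sym at-u)) ∷ keeps M (All≢⇒∉ u∉M) (All≢⇒∉ w∉M) sM , keeps N u∉N w∉N sN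
    where open Recolour (recolour χ true u≢w)
  two-colouring ((u , w) ∷ M) N ((u≢w ∷ u∉M) ∷ w∉M ∷ uM) uN | no u∉N | yes w∈N with partner N w∈N
  ... | y , N′ , e , p with Unique-↭ p uN
  ... | (w≢y ∷ w∉N′) ∷ _ ∷ uN′ with two-colouring M N′ uM uN′
  ... | χ , sM , sN =
    χ′ , ≡.trans at-w (cong not (≡.sym at-u)) ∷ keeps M (All≢⇒∉ u∉M) (All≢⇒∉ w∉M) sM ,
    separated χ′ e (Separates-sym χ′ (≡.trans at-w (cong not (≡.sym (fixes u≢y w≢y)))))
      (keeps N′ (λ h → u∉N (Perm.∈-resp-↭ (↭-sym p) (there (there h)))) (All≢⇒∉ w∉N′) sN)
    where
    open Recolour (recolour χ (χ y) u≢w)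
    u≢y : u ≢ y
    u≢y u≡y = u∉N (Perm.∈-resp-↭ (↭-sym p) (there (here u≡y)))
  two-colouring ((u , w) ∷ M) N ((u≢w ∷ u∉M) ∷ w∉M ∷ uM) uN | yes u∈N with partner N u∈N
  ... | y , N′ , e , p with Unique-↭ p uN
  ... | (u≢y ∷ u∉N′) ∷ y∉N′ ∷ uN′ with w ≟ y
  -- The edge belongs to both matchings, so any two opposite colours will do.
  ... | yes ≡.refl with two-colouring M N′ uM uN′
  ... | χ , sM , sN =
    χ′ , uw ∷ keeps M (All≢⇒∉ u∉M) (All≢⇒∉ w∉M) sM , separated χ′ e uw (keeps N′ (All≢⇒∉ u∉N′) (All≢⇒∉ y∉N′) sN)
    where
    open Recolour (recolour χ true u≢w)
    uw : Separates χ′ (u , w)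
    uw = ≡.trans at-w (cong not (≡.sym at-u))
  two-colouring ((u , w) ∷ M) N ((u≢w ∷ u∉M) ∷ w∉M ∷ uM) uN | yes u∈N | y , N′ , e , p | (u≢y ∷ u∉N′) ∷ y∉N′ ∷ uN′ | no w≢y with w ∈? flatten N′
  ... | no w∉N′ with two-colouring M N′ uM uN′
  ... | χ , sM , sN =
    χ′ , ≡.trans at-w (cong not (≡.sym at-u)) ∷ keeps M (All≢⇒∉ u∉M) (All≢⇒∉ w∉M) sM ,
    separated χ′ e (Separates-sym χ′ (≡.trans at-u (cong not (≡.sym (fixes u≢y w≢y)))))
      (keeps N′ (All≢⇒∉ u∉N′) w∉N′ sN)
    where open Recolour (recolour χ (not (χ y)) u≢w)
  -- The path `y`, `u`, `w`, `z` is contracted to an edge between `y` and `z`. As these receive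
  -- opposite colours, colouring `u` against `y` and `w` against `z` also separates `u` from `w`.
  two-colouring ((u , w) ∷ M) N ((u≢w ∷ u∉M) ∷ w∉M ∷ uM) uN | yes u∈N | y , N′ , e , p | (u≢y ∷ u∉N′) ∷ y∉N′ ∷ uN′ | no w≢y | yes w∈N′ with partner N′ w∈N′
  ... | z , N″ , e′ , p′ with Unique-↭ p′ uN′ | Perm.All-resp-↭ p′ u∉N′ | Perm.All-resp-↭ p′ y∉N′
  ... | (w≢z ∷ w∉N″) ∷ z∉N″ ∷ uN″ | _ ∷ u≢z ∷ u∉N″ | _ ∷ y≢z ∷ y∉N″ with
    two-colouring M ((y , z) ∷ N″) uM ((y≢z ∷ y∉N″) ∷ z∉N″ ∷ uN″)
  ... | χ , sM , yz ∷ sN =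
    χ′ , ≡.trans at-w (cong not (≡.sym at-u)) ∷ keeps M (All≢⇒∉ u∉M) (All≢⇒∉ w∉M) sM ,
    separated χ′ e (Separates-sym χ′ (≡.trans at-u (cong not (≡.sym (fixes u≢y w≢y)))))
      (separated χ′ e′ (Separates-sym χ′ (≡.trans at-w (cong not (≡.trans (≡.sym yz) (≡.sym (fixes u≢z w≢z))))))
        (keeps N″ (All≢⇒∉ u∉N″) (All≢⇒∉ w∉N″) sN))
    where open Recolour (recolour χ (not (χ y)) u≢w)

  module _ {X : Set} (_≟ˣ_ : DecidableEquality X) (L : V → X) (a : V → ℕ) where

    labelled : X → V → ℕ
    labelled c x = on (L x ≟ˣ c) (a x)

    retained : (V → Bool) → Bool → X → V → ℕ
    retained χ b c x = on ((L x ≟ˣ c) ×-dec (χ x Boolₚ.≟ b)) (a x)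

    -- For any colouring that separates the pairs of `M`, each of the two colours retains half of
    -- every label class, up to one good.
    Balanced : List (V × V) → List V → Set
    Balanced M xs = ∀ χ b → All (Separates χ) M → ∀ c B → All (λ x → L x ≡ c → a x ≤ B) xs →
                    total (labelled c) xs ≤ 2 * total (retained χ b c) xs + B

    private
      first-match : ∀ ℓ ys → All (λ y → L y ≢ ℓ) ys ⊎
                    (∃₂ λ pre e → ∃ λ post → ys ≡ pre ++ e ∷ post × All (λ y → L y ≢ ℓ) pre × L e ≡ ℓ)
      first-match ℓ [] = inj₁ []
      first-match ℓ (y ∷ ys) with L y ≟ˣ ℓ
      ... | yes y≡ = inj₂ ([] , y , ys , ≡.refl , [] , y≡)
      ... | no  y≢ with first-match ℓ ys
      ... | inj₁ h = inj₁ (y≢ ∷ h)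
      ... | inj₂ (pre , e , post , ≡.refl , h , e≡) = inj₂ (y ∷ pre , e , post , ≡.refl , y≢ ∷ h , e≡)

      unlabelled : ∀ c {xs} → All (λ x → L x ≢ c) xs → total (labelled c) xs ≡ 0
      unlabelled c [] = ≡.refl
      unlabelled c {x ∷ xs} (h ∷ hs) = cong₂ _+_ (on-no (L x ≟ˣ c) (a x) h) (unlabelled c hs)

    -- Each pair retains at least its smaller good, which is worth at least the larger good of the
    -- next pair.
    matching : ∀ k xs → length xs ≤ k → AllPairs (λ x y → a y ≤ a x) xs →
               ∃₂ λ M r → flatten M ++ r ↭ xs × Balanced M xs
    matching k [] _ _ = [] , [] , refl , λ _ _ _ _ _ _ → z≤n
    matching (suc k) (e ∷ ys) (s≤s len) (h ∷ s) with first-match (L e) ys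
    ... | inj₁ none with matching k ys len s
    ... | M , r , p , bal = M , e ∷ r , trans (Perm.shift e (flatten M) r) (prep e p) , balanced
      where
      balanced : Balanced M (e ∷ ys)
      balanced χ b sep c B (eB ∷ yB) = cases (L e ≟ˣ c)
        where
        open ≤-Reasoning
        ρ = retained χ b c
        cases : Dec (L e ≡ c) → labelled c e + total (labelled c) ys ≤ 2 * (ρ e + total ρ ys) + B
        cases (no e≢) = begin
          labelled c e + total (labelled c) ys   ≡⟨ cong (_+ total (labelled c) ys) (on-no (L e ≟ˣ c) (a e) e≢) ⟩
          total (labelled c) ys                  ≤⟨ bal χ b sep c B yB ⟩
          2 * total ρ ys + B                     ≤⟨ +-monoˡ-≤ B (*-monoʳ-≤ 2 (m≤n+m (total ρ ys) (ρ e))) ⟩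
          2 * (ρ e + total ρ ys) + B             ∎
        cases (yes e≡) = begin
          labelled c e + total (labelled c) ys   ≡⟨ cong₂ _+_ (on-yes (L e ≟ˣ c) (a e) e≡) (unlabelled c (All.map (λ n l → n (≡.trans l (≡.sym e≡))) none)) ⟩
          a e + 0                                ≡⟨ +-identityʳ (a e) ⟩
          a e                                    ≤⟨ eB e≡ ⟩
          B                                      ≤⟨ m≤n+m B _ ⟩
          2 * (ρ e + total ρ ys) + B             ∎
    matching (suc k) (e ∷ ys) (s≤s len) (h ∷ s) | inj₂ (pre , e′ , post , ≡.refl , none , e′≡e) with
      matching k (pre ++ post) (≤-trans (≤-trans (n≤1+n _) (≤-reflexive (≡.sym (Perm.↭-length (Perm.shift e′ pre post))))) len) (AllPairs-delete pre s)
    ... | M , r , p , bal = (e , e′) ∷ M , r , trans (prep e (prep e′ p)) (prep e (↭-sym (Perm.shift e′ pre post))) , balanced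
      where
      a≤ : a e′ ≤ a e
      a≤ = All.head (Allₚ.++⁻ʳ pre h)
      balanced : Balanced ((e , e′) ∷ M) (e ∷ pre ++ e′ ∷ post)
      balanced χ b (sep ∷ seps) c B (eB ∷ yB) = begin
        labelled c e + total (labelled c) (pre ++ e′ ∷ post)               ≡⟨ cong (labelled c e +_) (total-↭ (labelled c) (Perm.shift e′ pre post)) ⟩
        labelled c e + (labelled c e′ + total (labelled c) (pre ++ post))  ≤⟨ cases (L e ≟ˣ c) ⟩
        2 * (ρ e + (ρ e′ + R)) + B                                         ≡⟨ cong (λ t → 2 * (ρ e + t) + B) (total-↭ ρ (Perm.shift e′ pre post)) ⟨
        2 * (ρ e + total ρ (pre ++ e′ ∷ post)) + B                         ∎
        where
        open ≤-Reasoning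
        ρ = retained χ b c
        R = total ρ (pre ++ post)
        T = total (labelled c) (pre ++ post)
        cases : Dec (L e ≡ c) → labelled c e + (labelled c e′ + T) ≤ 2 * (ρ e + (ρ e′ + R)) + B
        cases (no e≢) = begin
          labelled c e + (labelled c e′ + T)   ≡⟨ cong₂ (λ s t → s + (t + T)) (on-no (L e ≟ˣ c) (a e) e≢) (on-no (L e′ ≟ˣ c) (a e′) (λ l → e≢ (≡.trans (≡.sym e′≡e) l))) ⟩
          T                                    ≤⟨ bal χ b seps c B (Allₚ.++⁺ (Allₚ.++⁻ˡ pre yB) (All.tail (Allₚ.++⁻ʳ pre yB))) ⟩
          2 * R + B                            ≤⟨ +-monoˡ-≤ B (*-monoʳ-≤ 2 (≤-trans (m≤n+m R (ρ e′)) (m≤n+m _ (ρ e)))) ⟩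
          2 * (ρ e + (ρ e′ + R)) + B           ∎
        cases (yes e≡) = begin
          labelled c e + (labelled c e′ + T)   ≡⟨ cong₂ (λ s t → s + (t + T)) (on-yes (L e ≟ˣ c) (a e) e≡) (on-yes (L e′ ≟ˣ c) (a e′) e′≡) ⟩
          a e + (a e′ + T)                     ≤⟨ linear _ _ 0 (+-mono-≤ (eB e≡) (+-mono-≤ (+-mono-≤ kept kept) ih)) (identity (a e) (a e′) T R (ρ e) (ρ e′) B) ⟩
          2 * (ρ e + (ρ e′ + R)) + B           ∎
          where
          e′≡ : L e′ ≡ c
          e′≡ = ≡.trans e′≡e e≡
          -- Every remaining good with the label of `e` comes after `e′`, so the induction
          -- hypothesis applies with `a e′` as its bound. The two copies of `a e′` that arise are
          -- paid for by twice the good retained from this pair.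
          ih : T ≤ 2 * R + a e′
          ih = bal χ b seps c (a e′) (Allₚ.++⁺
            (All.map (λ n l → contradiction (≡.trans l (≡.sym e≡)) n) none)
            (All.map (λ y≤ _ → y≤) (AllPairs.head (AllPairs-++⁻ʳ pre s))))
          kept : a e′ ≤ ρ e + ρ e′
          kept with χ e Boolₚ.≟ b
          ... | yes χe = ≤-trans a≤ (≤-trans (≤-reflexive (≡.sym (on-yes ((L e ≟ˣ c) ×-dec yes χe) (a e) (e≡ , χe)))) (m≤m+n _ _))
          ... | no χe≢ = ≤-trans (≤-reflexive (≡.sym (on-yes ((L e′ ≟ˣ c) ×-dec (χ e′ Boolₚ.≟ b)) (a e′)
                  (e′≡ , ≡.trans sep (≡.sym (Boolₚ.¬-not (≢-sym χe≢))))))) (m≤n+m _ _)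
          identity : ∀ x y t r p q b → x + (y + t) + (b + ((p + q) + (p + q) + (2 * r + y))) + 0
                   ≡ 2 * (p + (q + r)) + b + (x + ((y + y) + t))
          identity = solve-∀

  -- One colouring separates both matchings; the first labelling keeps colour `true` and the second
  -- keeps `false`, so no good is used twice.
  halve : ∀ {X : Set} (_≟ˣ_ : DecidableEquality X) (L₁ L₂ : V → X) (a₁ a₂ : V → ℕ) xs → Unique xs →
    ∃ λ χ → ∀ c B →
    (All (λ x → L₁ x ≡ c → a₁ x ≤ B) xs → total (labelled _≟ˣ_ L₁ a₁ c) xs ≤ 2 * total (retained _≟ˣ_ L₁ a₁ χ true c) xs + B) ×
    (All (λ x → L₂ x ≡ c → a₂ x ≤ B) xs → total (labelled _≟ˣ_ L₂ a₂ c) xs ≤ 2 * total (retained _≟ˣ_ L₂ a₂ χ false c) xs + B)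
  halve {X} _≟ˣ_ L₁ L₂ a₁ a₂ xs u =
    let χ , s₁ , s₂ = two-colouring (M a₁ L₁) (M a₂ L₂) (unique a₁ L₁) (unique a₂ L₂)
    in χ , λ c B → bound a₁ L₁ χ true s₁ c B , bound a₂ L₂ χ false s₂ c B
    where
    matched : (a : V → ℕ) (L : V → X) → ∃₂ λ M r → flatten M ++ r ↭ proj₁ (sort-by a xs) × Balanced _≟ˣ_ L a M (proj₁ (sort-by a xs))
    matched a L = matching _≟ˣ_ L a _ _ ≤-refl (proj₂ (proj₂ (sort-by a xs)))
    sorted↭ : ∀ a → proj₁ (sort-by a xs) ↭ xs
    sorted↭ a = proj₁ (proj₂ (sort-by a xs))
    M : (a : V → ℕ) (L : V → X) → List (V × V)
    M a L = proj₁ (matched a L)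
    unique : ∀ a L → Unique (flatten (M a L))
    unique a L = AllPairs-++⁻ˡ (flatten (M a L)) (Unique-↭ (↭-sym (trans (proj₁ (proj₂ (proj₂ (matched a L)))) (sorted↭ a))) u)
    bound : ∀ a L χ b → All (Separates χ) (M a L) → ∀ c B → All (λ x → L x ≡ c → a x ≤ B) xs →
            total (labelled _≟ˣ_ L a c) xs ≤ 2 * total (retained _≟ˣ_ L a χ b c) xs + B
    bound a L χ b s c B h = ≡.subst₂ (λ x y → x ≤ 2 * y + B) (total-↭ _ (sorted↭ a)) (total-↭ _ (sorted↭ a))
      (proj₂ (proj₂ (proj₂ (matched a L))) χ b s c B (Perm.All-resp-↭ (↭-sym (sorted↭ a)) h))

-- The leading binary digit of a type. As `2 ^ suc k` unfolds to `2 ^ k + (2 ^ k + 0)`, the second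
-- half needs an extra injection.
join : ∀ k → Bool → Fin (2 ^ k) → Fin (2 ^ suc k)
join k true  s = s Fin.↑ˡ (2 ^ k + 0)
join k false s = 2 ^ k Fin.↑ʳ (s Fin.↑ˡ 0)

split : ∀ k (s : Fin (2 ^ suc k)) → ∃₂ λ b s′ → join k b s′ ≡ s
split k s with Fin.splitAt (2 ^ k) s in eq
... | inj₁ s′ = true , s′ , splitAt⁻¹-↑ˡ eq
... | inj₂ s″ with Fin.splitAt (2 ^ k) s″ in eq′
... | inj₁ s′ = false , s′ , ≡.trans (cong (2 ^ k Fin.↑ʳ_) (splitAt⁻¹-↑ˡ eq′)) (splitAt⁻¹-↑ʳ eq)

-- With B added on both sides the losses of the successive halvings telescope.
distribute : ∀ k {m} {X : Set} (_≟ˣ_ : DecidableEquality X) (L : Fin (2 ^ k) → Fin m → X) (a : Fin (2 ^ k) → Fin m → ℕ) →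
  ∃ λ (τ : Fin m → Fin (2 ^ k)) → ∀ s c B → (∀ x → L s x ≡ c → a s x ≤ B) →
  total (λ x → on (L s x ≟ˣ c) (a s x)) (allFin m) + B ≤
  2 ^ k * (total (λ x → on ((L s x ≟ˣ c) ×-dec (τ x Fin.≟ s)) (a s x)) (allFin m) + B)
distribute zero {m} _≟ˣ_ L a = (λ _ → Fin.zero) , λ where
  Fin.zero c B _ → ≤-trans (+-monoˡ-≤ B (total-mono (All.universal (λ x → on-mono (L Fin.zero x ≟ˣ c) ((L Fin.zero x ≟ˣ c) ×-dec yes ≡.refl) (λ l → (l , ≡.refl) , ≤-refl)) (allFin m))))
    (≤-reflexive (≡.sym (*-identityˡ _)))
distribute (suc k) {m} {X} _≟ˣ_ L a with
  distribute k _≟ˣ_ (λ s → L (join k true s)) (λ s → a (join k true s)) |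
  distribute k _≟ˣ_ (λ s → L (join k false s)) (λ s → a (join k false s))
... | τ₀ , ok₀ | τ₁ , ok₁ with
  -- In either half, the label of a good is the type chosen for it there together with its label
  -- under that type. A single colouring thus halves the classes of all types at once.
  halve Fin._≟_ (≡-dec Fin._≟_ _≟ˣ_) (λ x → τ₀ x , L (join k true (τ₀ x)) x) (λ x → τ₁ x , L (join k false (τ₁ x)) x)
    (λ x → a (join k true (τ₀ x)) x) (λ x → a (join k false (τ₁ x)) x) (allFin m) (allFin⁺ m)
... | χ , half = τ , λ s c B → bound s (split k s) c B
  where
  open ≤-Reasoning
  τᵢ : Bool → Fin m → Fin (2 ^ k)
  τᵢ true  = τ₀
  τᵢ false = τ₁
  τ : Fin m → Fin (2 ^ suc k)
  τ x = join k (χ x) (τᵢ (χ x) x)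
  Small : X → ℕ → Fin (2 ^ suc k) → Set
  Small c B s = ∀ x → L s x ≡ c → a s x ≤ B
  kept : X → Fin (2 ^ suc k) → Fin m → ℕ
  kept c s x = on ((L s x ≟ˣ c) ×-dec (τ x Fin.≟ s)) (a s x)
  Goal : X → ℕ → Fin (2 ^ suc k) → Set
  Goal c B s = total (λ x → on (L s x ≟ˣ c) (a s x)) (allFin m) + B ≤ 2 ^ suc k * (total (kept c s) (allFin m) + B)

  conclude : ∀ b s c B →
    (Small c B (join k b s) → total (λ x → on (L (join k b s) x ≟ˣ c) (a (join k b s) x)) (allFin m) + B ≤
       2 ^ k * (total (λ x → on ((L (join k b s) x ≟ˣ c) ×-dec (τᵢ b x Fin.≟ s)) (a (join k b s) x)) (allFin m) + B)) →
    (let L′ = λ x → τᵢ b x , L (join k b (τᵢ b x)) x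
         a′ = λ x → a (join k b (τᵢ b x)) x in
     All (λ x → L′ x ≡ (s , c) → a′ x ≤ B) (allFin m) →
     total (labelled Fin._≟_ (≡-dec Fin._≟_ _≟ˣ_) L′ a′ (s , c)) (allFin m) ≤
     2 * total (retained Fin._≟_ (≡-dec Fin._≟_ _≟ˣ_) L′ a′ χ b (s , c)) (allFin m) + B) →
    Small c B (join k b s) → Goal c B (join k b s)
  conclude b s c B ok half small = begin
    total (λ x → on (L s′ x ≟ˣ c) (a s′ x)) (allFin m) + B                                     ≤⟨ ok small ⟩
    2 ^ k * (total (λ x → on ((L s′ x ≟ˣ c) ×-dec (τᵢ b x Fin.≟ s)) (a s′ x)) (allFin m) + B)
      ≤⟨ *-monoʳ-≤ (2 ^ k) (+-monoˡ-≤ B (≤-trans (total-mono (All.universal before (allFin m))) (half (All.universal bounded (allFin m))))) ⟩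
    2 ^ k * (2 * total (retained Fin._≟_ (≡-dec Fin._≟_ _≟ˣ_) L′ a′ χ b (s , c)) (allFin m) + B + B)
      ≤⟨ *-monoʳ-≤ (2 ^ k) (+-monoˡ-≤ B (+-monoˡ-≤ B (*-monoʳ-≤ 2 (total-mono (All.universal afterwards (allFin m)))))) ⟩
    2 ^ k * (2 * total (kept c s′) (allFin m) + B + B)                                         ≡⟨ identity (2 ^ k) (total (kept c s′) (allFin m)) B ⟩
    2 ^ suc k * (total (kept c s′) (allFin m) + B)                                             ∎
    where
    s′ = join k b s
    L′ : Fin m → Fin (2 ^ k) × X
    L′ x = τᵢ b x , L (join k b (τᵢ b x)) x
    a′ : Fin m → ℕ
    a′ x = a (join k b (τᵢ b x)) x
    identity : ∀ t r b → t * (2 * r + b + b) ≡ (t + (t + 0)) * (r + b)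
    identity = solve-∀
    bounded : ∀ x → L′ x ≡ (s , c) → a′ x ≤ B
    bounded x ≡.refl = small x ≡.refl
    before : ∀ x → on ((L s′ x ≟ˣ c) ×-dec (τᵢ b x Fin.≟ s)) (a s′ x) ≤ labelled Fin._≟_ (≡-dec Fin._≟_ _≟ˣ_) L′ a′ (s , c) x
    before x = on-mono ((L s′ x ≟ˣ c) ×-dec (τᵢ b x Fin.≟ s)) (≡-dec Fin._≟_ _≟ˣ_ (L′ x) (s , c)) λ { (≡.refl , ≡.refl) → ≡.refl , ≤-refl }
    afterwards : ∀ x → retained Fin._≟_ (≡-dec Fin._≟_ _≟ˣ_) L′ a′ χ b (s , c) x ≤ kept c s′ x
    afterwards x = on-mono (≡-dec Fin._≟_ _≟ˣ_ (L′ x) (s , c) ×-dec (χ x Boolₚ.≟ b)) ((L s′ x ≟ˣ c) ×-dec (τ x Fin.≟ s′)) λ { (≡.refl , ≡.refl) → (≡.refl , ≡.refl) , ≤-refl }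

  bound : ∀ s → (∃₂ λ b s′ → join k b s′ ≡ s) → ∀ c B → Small c B s → Goal c B s
  bound _ (true , s , ≡.refl)  c B = conclude true s c B (ok₀ s c B) (proj₁ (half (s , c) B))
  bound _ (false , s , ≡.refl) c B = conclude false s c B (ok₁ s c B) (proj₂ (half (s , c) B))

-- Split graphs

≤-total-∈ : ∀ {A : Set} (f : A → ℕ) {x xs} → x ∈ xs → f x ≤ total f xs
≤-total-∈ f (here ≡.refl) = m≤m+n _ _
≤-total-∈ f (there x∈)    = m≤n⇒m≤o+n _ (≤-total-∈ f x∈)

total-zero : ∀ {A : Set} {f : A → ℕ} {xs} → All (λ x → f x ≡ 0) xs → total f xs ≡ 0
total-zero []       = ≡.refl
total-zero (h ∷ hs) = cong₂ _+_ h (total-zero hs)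

total-single : ∀ {A : Set} {X : A → Set} (X? : ∀ x → Dec (X x)) (f : A → ℕ) {x₀ xs} → Unique xs →
               (∀ x → X x → x ≡ x₀) → total (λ x → on (X? x) (f x)) xs ≤ f x₀
total-single X? f [] _ = z≤n
total-single X? f {x₀} {x ∷ xs} (x∉ ∷ u) only with X? x
... | no _  = total-single X? f u only
... | yes h with only x h
... | ≡.refl = ≤-reflexive (≡.trans (cong (f x +_) (total-zero (All.map (λ {y} x≢y → on-no (X? y) (f y) (λ h → x≢y (≡.sym (only y h)))) x∉))) (+-identityʳ _))

total-on : ∀ {A X : Set} (X? : Dec X) (f : A → ℕ) xs → on X? (total f xs) ≡ total (λ x → on X? (f x)) xs
total-on (yes _) f xs = ≡.refl
total-on (no _)  f xs = ≡.sym (total-zero (All.universal (λ _ → ≡.refl) xs))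

total-+ : ∀ {A : Set} (f g : A → ℕ) xs → total (λ x → f x + g x) xs ≡ total f xs + total g xs
total-+ f g []       = ≡.refl
total-+ f g (x ∷ xs) = ≡.trans (cong (f x + g x +_) (total-+ f g xs)) (shuffle (f x) (g x) (total f xs) (total g xs))
  where
  shuffle : ∀ a b c d → a + b + (c + d) ≡ a + c + (b + d)
  shuffle = solve-∀

total-swap : ∀ {A B : Set} (f : A → B → ℕ) xs ys →
             total (λ x → total (f x) ys) xs ≡ total (λ y → total (λ x → f x y) xs) ys
total-swap f [] ys       = ≡.sym (total-zero (All.universal (λ _ → ≡.refl) ys))
total-swap f (x ∷ xs) ys = ≡.trans (cong (total (f x) ys +_) (total-swap f xs ys))
  (≡.sym (total-+ (f x) (λ y → total (λ x → f x y) xs) ys))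

worth : ∀ {m n} → (Fin m → ℕ) → (Fin m → Fin n) → Fin n → ℕ
worth w P j = total (λ v → on (P v Fin.≟ j) (w v)) (allFin _)

worth-cong : ∀ {m n} (w : Fin m → ℕ) {P Q : Fin m → Fin n} → (∀ v → P v ≡ Q v) → ∀ j → worth w P j ≤ worth w Q j
worth-cong w {P} {Q} P≗Q j = total-mono (All.universal (λ v → on-mono (P v Fin.≟ j) (Q v Fin.≟ j) (λ e → ≡.trans (≡.sym (P≗Q v)) e , ≤-refl)) (allFin _))

-- Partitions are enumerated as vectors. A function agrees with its tabulation only pointwise, which
-- is what `worth-cong` and `Hub-cong` are for.
any-vec? : ∀ {n} m {Q : Vec (Fin n) m → Set} → Decidable Q → Dec (∃ Q)
any-vec? zero    Q? = map′ (Vec.[] ,_) (λ { (Vec.[] , q) → q }) (Q? Vec.[])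
any-vec? (suc m) Q? = map′ (λ (x , xs , q) → x Vec.∷ xs , q) (λ { (x Vec.∷ xs , q) → x , xs , q })
  (any? (λ x → any-vec? m (λ xs → Q? (x Vec.∷ xs))))

largest : ∀ {Q : ℕ → Set} → Decidable Q → Q 0 → ∀ N → ∃ λ μ → Q μ × (∀ ν → ν ≤ N → Q ν → ν ≤ μ)
largest Q? q₀ zero = 0 , q₀ , λ _ ν≤ _ → ν≤
largest Q? q₀ (suc N) with Q? (suc N)
... | yes q = suc N , q , λ _ ν≤ _ → ν≤
... | no ¬q with largest Q? q₀ N
... | μ , q , max = μ , q , λ ν ν≤ qν → max ν (s≤s⁻¹ (≤∧≢⇒< ν≤ (λ { ≡.refl → ¬q qν }))) qν

module SplitGraph {m : ℕ} (G : Graph m) (inK : Fin m → Bool)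
  (clique : ∀ u v → inK u ≡ true → inK v ≡ true → u ≢ v → adj G u v ≡ true)
  (independent : ∀ u v → inK u ≡ false → inK v ≡ false → adj G u v ≡ false) where

  -- A part of a split graph is connected iff each of its independent vertices has a neighbour in the
  -- clique side of the part, or is the whole part.
  Hub : ∀ {n} → (Fin m → Fin n) → Set
  Hub P = ∀ v → inK v ≡ false →
    (∃ λ x → inK x ≡ true × P x ≡ P v × adj G v x ≡ true) ⊎ (∀ u → P u ≡ P v → u ≡ v)

  private
    clique-neighbour : ∀ {u v} → inK u ≡ false → adj G u v ≡ true → inK v ≡ true
    clique-neighbour {u} {v} u∈I uv with inK v in eq
    ... | true  = ≡.refl
    ... | false with ≡.trans (≡.sym uv) (independent u v u∈I eq)
    ... | ()

    part-in : ∀ {n} (P : Fin m → Fin n) {j v} → P v ≡ j → part P j v ≡ true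
    part-in P {j} {v} e with P v Fin.≟ j
    ... | yes _ = ≡.refl
    ... | no ¬e = contradiction e ¬e

    part-out : ∀ {n} (P : Fin m → Fin n) {j v} → part P j v ≡ true → P v ≡ j
    part-out P {j} {v} h with P v Fin.≟ j
    ... | yes e = e
    part-out P {j} {v} () | no _

    first-step : ∀ {X : Fin m → Bool} {u v} → u ≢ v → WalkIn G X u v → ∃ λ w → X w ≡ true × adj G u w ≡ true
    first-step u≢v (here _) = contradiction ≡.refl u≢v
    first-step u≢v (step {w = w} _ uw (here Xw)) = w , Xw , uw
    first-step u≢v (step {w = w} _ uw (step Xw _ _)) = w , Xw , uw

  -- A walk inside the part to another vertex begins with an edge at `v`, and its other end lies in
  -- the clique because `v` is independent.
  partition⇒Hub : ∀ {n} {P : Fin m → Fin n} → IsPartition G n P → Hub P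
  partition⇒Hub {P = P} bundles v v∈I with any? (λ u → (P u Fin.≟ P v) ×-dec ¬? (u Fin.≟ v))
  ... | no alone = inj₂ λ u e → decidable-stable (u Fin.≟ v) (λ u≢v → alone (u , e , u≢v))
  ... | yes (u , e , u≢v) with first-step (≢-sym u≢v) (bundles (P v) v u (part-in P ≡.refl) (part-in P e))
  ... | w , Xw , vw = inj₁ (w , clique-neighbour v∈I vw , part-out P Xw , vw)

  Hub⇒partition : ∀ {n} {P : Fin m → Fin n} → Hub P → IsPartition G n P
  Hub⇒partition {n} {P} hub j u v Xu Xv = join-up (to-clique u Xu) (to-clique v Xv)
    where
    X = part P j
    -- Both directions are recorded, a way to prepend the edge from `u` to `x` and a walk back from
    -- `x` to `u`, since `Reach` is used for the start as well as for the end of a walk.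
    Reach : Fin m → Set
    Reach u = (∀ v → X v ≡ true → v ≡ u) ⊎
      (∃ λ x → inK x ≡ true × X x ≡ true × (∀ {y} → WalkIn G X x y → WalkIn G X u y) × WalkIn G X x u)
    to-clique : ∀ u → X u ≡ true → Reach u
    to-clique u Xu with inK u in eq
    ... | true  = inj₂ (u , eq , Xu , id , here Xu)
    ... | false with hub u eq
    ... | inj₂ alone = inj₁ λ v Xv → alone v (≡.trans (part-out P Xv) (≡.sym (part-out P Xu)))
    ... | inj₁ (x , x∈K , Px , ux) = inj₂ (x , x∈K , Xx , step Xu ux , step Xx (≡.trans (adj-sym G x u) ux) (here Xu))
      where
      Xx : X x ≡ true
      Xx = part-in P (≡.trans Px (part-out P Xu))
    join-up : Reach u → Reach v → WalkIn G X u v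
    join-up (inj₁ alone) _ with alone v Xv
    ... | ≡.refl = here Xu
    join-up (inj₂ _) (inj₁ alone) with alone u Xu
    ... | ≡.refl = here Xv
    join-up (inj₂ (x , x∈K , Xx , from , _)) (inj₂ (y , y∈K , Xy , _ , to)) with x Fin.≟ y
    ... | no x≢y = from (step Xx (clique x y x∈K y∈K x≢y) to)
    ... | yes ≡.refl = from to

  hub? : ∀ {n} (P : Fin m → Fin n) → Dec (Hub P)
  hub? P = all? λ v → (inK v Boolₚ.≟ false) →-dec
    (any? (λ x → (inK x Boolₚ.≟ true) ×-dec ((P x Fin.≟ P v) ×-dec (adj G v x Boolₚ.≟ true)))
     ⊎-dec all? (λ u → (P u Fin.≟ P v) →-dec (u Fin.≟ v)))

  Hub-cong : ∀ {n} {P Q : Fin m → Fin n} → (∀ v → P v ≡ Q v) → Hub P → Hub Q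
  Hub-cong P≗Q hub v v∈I with hub v v∈I
  ... | inj₁ (x , x∈K , e , vx) = inj₁ (x , x∈K , ≡.trans (≡.sym (P≗Q x)) (≡.trans e (P≗Q v)) , vx)
  ... | inj₂ alone = inj₂ λ u e → alone u (≡.trans (P≗Q u) (≡.trans e (≡.sym (P≗Q v))))

  PartialHub : ∀ {n} → (Fin m → Maybe (Fin n)) → Set
  PartialHub own = ∀ v j → own v ≡ just j → inK v ≡ false →
    (∃ λ x → inK x ≡ true × own x ≡ just j × adj G v x ≡ true) ⊎ (∀ u → own u ≡ just j → u ≡ v)

  module _ (connected : Connected G) where

    connected⇒Hub : ∀ {n} (j : Fin n) → Hub (λ _ → j)
    connected⇒Hub j v v∈I with any? (λ u → ¬? (u Fin.≟ v))
    ... | no alone = inj₂ λ u _ → decidable-stable (u Fin.≟ v) (λ u≢v → alone (u , u≢v))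
    ... | yes (u , u≢v) with first-step (≢-sym u≢v) (connected v u ≡.refl ≡.refl)
    ... | w , _ , vw = inj₁ (w , clique-neighbour v∈I vw , ≡.refl , vw)

    -- The maximin share for integer weights, by exhaustive search. The value 0 is achieved by
    -- giving everything to `j₀`, as `G` is connected, and the worth of a single part bounds the
    -- search by the total weight.
    best-partition : ∀ {n} → Fin n → (w : Fin m → ℕ) → ∃₂ λ μ (P : Fin m → Fin n) →
      Hub P × (∀ j → μ ≤ worth w P j) × (∀ Q ν → Hub Q → (∀ j → ν ≤ worth w Q j) → ν ≤ μ)
    best-partition {n} j₀ w with largest achievable? (tabulate (λ _ → j₀) , Hub-cong (λ v → ≡.sym (lookup∘tabulate _ v)) (connected⇒Hub j₀) , λ _ → z≤n) (total w (allFin m))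
      where
      achievable? : Decidable (λ ν → ∃ λ (xs : Vec (Fin n) m) → Hub (lookup xs) × (∀ j → ν ≤ worth w (lookup xs) j))
      achievable? ν = any-vec? m (λ xs → hub? (lookup xs) ×-dec all? (λ j → ν ≤? worth w (lookup xs) j))
    ... | μ , (xs , hub , μ≤) , max = μ , lookup xs , hub , μ≤ , λ Q ν hubQ ν≤ →
      max ν (≤-trans (ν≤ j₀) (total-mono (All.universal (λ v → on≤ (Q v Fin.≟ j₀) (w v)) (allFin m))))
        (tabulate Q , Hub-cong (λ v → ≡.sym (lookup∘tabulate Q v)) hubQ ,
         λ j → ≤-trans (ν≤ j) (worth-cong w (λ v → ≡.sym (lookup∘tabulate Q v)) j))
      where
      on≤ : ∀ {X : Set} (X? : Dec X) x → on X? x ≤ x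
      on≤ (yes _) x = ≤-refl
      on≤ (no _)  x = z≤n

    -- Unassigned clique vertices all go to one agent, who already owns a clique vertex if anybody
    -- does; unassigned independent vertices follow a neighbour.
    extend : ∀ {n} → Fin n → (own : Fin m → Maybe (Fin n)) → PartialHub own →
             ∃ λ (A : Fin m → Fin n) → Hub A × (∀ v j → own v ≡ just j → A v ≡ j)
    extend {n} d own phub = A , hub , extends
      where
      Owned : Fin m → Set
      Owned x = inK x ≡ true × ∃ λ j → own x ≡ just j
      owned? : Dec (∃ Owned)
      owned? = any? λ x → (inK x Boolₚ.≟ true) ×-dec any? (λ j → Maybeₚ.≡-dec Fin._≟_ (own x) (just j))
      receiver : Dec (∃ Owned) → Fin n
      receiver (yes (_ , _ , j , _)) = j
      receiver (no _)                = d
      j₀ : Fin n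
      j₀ = receiver owned?
      neighbour : Fin m → Fin m
      neighbour v with any? (λ x → (inK x Boolₚ.≟ true) ×-dec (adj G v x Boolₚ.≟ true))
      ... | yes (x , _) = x
      -- For an independent `v` this happens only if `v` is the sole vertex of `G`.
      ... | no _        = v
      neighbour-ok : ∀ {v} → inK v ≡ false → (inK (neighbour v) ≡ true × adj G v (neighbour v) ≡ true) ⊎ (∀ u → u ≡ v)
      neighbour-ok {v} v∈I with any? (λ x → (inK x Boolₚ.≟ true) ×-dec (adj G v x Boolₚ.≟ true))
      ... | yes (x , h) = inj₁ h
      ... | no none with connected⇒Hub d v v∈I
      ... | inj₁ (x , x∈K , _ , vx) = contradiction (x , x∈K , vx) none
      ... | inj₂ alone = inj₂ λ u → alone u ≡.refl
      A-clique : Fin m → Fin n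
      A-clique x = fromMaybe j₀ (own x)
      A : Fin m → Fin n
      A v with own v | inK v
      ... | just j  | _     = j
      ... | nothing | true  = j₀
      ... | nothing | false = A-clique (neighbour v)
      extends : ∀ v j → own v ≡ just j → A v ≡ j
      extends v j eq with own v
      extends v j ≡.refl | just .j = ≡.refl
      A-on-clique : ∀ {x} → inK x ≡ true → A x ≡ A-clique x
      A-on-clique {x} x∈K with own x | inK x
      ... | just j  | _    = ≡.refl
      ... | nothing | true = ≡.refl
      A-follows : ∀ {v} → own v ≡ nothing → inK v ≡ false → A v ≡ A-clique (neighbour v)
      A-follows {v} eq v∈I with own v | inK v
      A-follows ≡.refl ≡.refl | nothing | false = ≡.refl
      clique-part : ∀ {x j} → own x ≢ just j → A-clique x ≡ j → j₀ ≡ j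
      clique-part {x} ne eq with own x
      ... | just i  = contradiction (cong just eq) ne
      ... | nothing = eq
      nobody-else : ∀ {v j} → own v ≡ just j → inK v ≡ false → (∀ u → own u ≡ just j → u ≡ v) →
                    ∀ {x} → inK x ≡ true → own x ≢ just j
      nobody-else ov v∈I alone {x} x∈K ox with alone x ox
      ... | ≡.refl with ≡.trans (≡.sym x∈K) v∈I
      ... | ()
      receiver-owns : (∃ λ x → inK x ≡ true × own x ≡ just j₀) ⊎ (∀ {x} → inK x ≡ true → A-clique x ≡ j₀)
      receiver-owns with owned?
      ... | yes (x , x∈K , j , ox) = inj₁ (x , x∈K , ox)
      ... | no none = inj₂ unowned
        where
        unowned : ∀ {x} → inK x ≡ true → fromMaybe d (own x) ≡ d
        unowned {x} x∈K with own x in eq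
        ... | just j  = contradiction (x , x∈K , j , eq) none
        ... | nothing = ≡.refl
      hub : Hub A
      hub v v∈I = by (own v) ≡.refl
        where
        Goal : Set
        Goal = (∃ λ x → inK x ≡ true × A x ≡ A v × adj G v x ≡ true) ⊎ (∀ u → A u ≡ A v → u ≡ v)
        alone-in-part : ∀ {j} → own v ≡ just j → (∀ u → own u ≡ just j → u ≡ v) → j₀ ≢ j → ∀ u → A u ≡ j → u ≡ v
        alone-in-part {j} ov alone j₀≢j u Au = case-of (own u) ≡.refl (inK u) ≡.refl
          where
          case-of : ∀ o → own u ≡ o → ∀ b → inK u ≡ b → u ≡ v
          case-of (just i) ou _ _ = alone u (≡.trans ou (cong just (≡.trans (≡.sym (extends u i ou)) Au)))
          case-of nothing ou true u∈K =
            contradiction (clique-part (nobody-else ov v∈I alone u∈K) (≡.trans (≡.sym (A-on-clique u∈K)) Au)) j₀≢j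
          case-of nothing ou false u∈I with neighbour-ok u∈I
          ... | inj₂ only = ≡.sym (only v)
          ... | inj₁ (x∈K , _) =
            contradiction (clique-part (nobody-else ov v∈I alone x∈K) (≡.trans (≡.sym (A-follows ou u∈I)) Au)) j₀≢j
        by : ∀ o → own v ≡ o → Goal
        by nothing ov with neighbour-ok v∈I
        ... | inj₂ alone = inj₂ λ u _ → alone u
        ... | inj₁ (x∈K , vx) = inj₁ (neighbour v , x∈K , ≡.trans (A-on-clique x∈K) (≡.sym (A-follows ov v∈I)) , vx)
        by (just j) ov with phub v j ov v∈I
        ... | inj₁ (x , x∈K , ox , vx) = inj₁ (x , x∈K , ≡.trans (extends x j ox) (≡.sym (extends v j ov)) , vx)
        ... | inj₂ alone with j₀ Fin.≟ j
        ... | no j₀≢j = inj₂ λ u e → alone-in-part ov alone j₀≢j u (≡.trans e (extends v j ov))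
        -- The receiver's only assigned vertex is the independent vertex `v`. Then no clique vertex
        -- was assigned, so all of them go to this receiver, among them a neighbour of `v`, unless
        -- `v` is the sole vertex.
        ... | yes j₀≡j with receiver-owns | neighbour-ok v∈I
        ... | inj₁ (x , x∈K , ox) | _ = contradiction (≡.trans ox (cong just j₀≡j)) (nobody-else ov v∈I alone x∈K)
        ... | inj₂ _ | inj₂ only = inj₂ λ u _ → only u
        ... | inj₂ all-j₀ | inj₁ (x∈K , vx) =
          inj₁ (neighbour v , x∈K , ≡.trans (A-on-clique x∈K) (≡.trans (all-j₀ x∈K) (≡.trans j₀≡j (≡.sym (extends v j ov)))) , vx)

-- From split graphs to complete graphs

class-split : ∀ {A : Set} {X : A → Set} (X? : ∀ x → Dec (X x)) xs →
              ∃₂ λ ys zs → xs ↭ ys ++ zs × All X ys × All (λ x → ¬ X x) zs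
class-split X? [] = [] , [] , refl , [] , []
class-split X? (x ∷ xs) with class-split X? xs | X? x
... | ys , zs , p , hy , hz | yes h = x ∷ ys , zs , prep x p , h ∷ hy , hz
... | ys , zs , p , hy , hz | no ¬h = ys , x ∷ zs , trans (prep x p) (↭-sym (Perm.shift x ys zs)) , hy , ¬h ∷ hz

Feasible-classes : ∀ {A : Set} {n q} (P : A → Fin n) (f : A → ℕ) js xs → Unique js →
  (∀ {j} → j ∈ js → q ≤ total (λ x → on (P x Fin.≟ j) (f x)) xs) → Feasible q (length js) (map f xs)
Feasible-classes P f [] xs _ _ = [] , map f xs , ≡.refl , [] , refl
Feasible-classes {q = q} P f (j ∷ js) xs (j∉ ∷ u) big with class-split (λ x → P x Fin.≟ j) xs
... | ys , zs , p , hy , hz with Feasible-classes P f js zs u (λ j′∈ → subst (q ≤_) (other (All.lookup j∉ j′∈)) (big (there j′∈)))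
  where
  other : ∀ {i} → j ≢ i → total (λ x → on (P x Fin.≟ i) (f x)) xs ≡ total (λ x → on (P x Fin.≟ i) (f x)) zs
  other {i} j≢i = ≡.trans (total-↭ _ p) (≡.trans (total-++ _ ys zs)
    (cong (_+ total (λ x → on (P x Fin.≟ i) (f x)) zs) (total-zero (All.map (λ {x} e → on-no (P x Fin.≟ i) (f x) (λ e′ → j≢i (≡.trans (≡.sym e) e′))) hy))))
... | bs , junk , l , bigs , r = map f ys ∷ bs , junk , cong suc l , first ∷ bigs ,
  trans (↭-reflexive (++-assoc (map f ys) (concat bs) junk))
    (trans (Perm.++⁺ˡ (map f ys) r) (trans (↭-reflexive (≡.sym (map-++ f ys zs))) (↭-sym (Perm.map⁺ f p))))
  where
  first : q ≤ total f ys
  first = begin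
    q                                                   ≤⟨ big (here ≡.refl) ⟩
    total g xs                                          ≡⟨ total-↭ g p ⟩
    total g (ys ++ zs)                                  ≡⟨ total-++ g ys zs ⟩
    total g ys + total g zs                             ≡⟨ cong (total g ys +_) (total-zero (All.map (λ {x} ne → on-no (P x Fin.≟ j) (f x) ne) hz)) ⟩
    total g ys + 0                                      ≡⟨ +-identityʳ _ ⟩
    total g ys                                          ≤⟨ total-mono (All.map (λ {x} e → ≤-reflexive (on-yes (P x Fin.≟ j) (f x) e)) hy) ⟩
    total f ys                                          ∎
    where
    open ≤-Reasoning
    g = λ x → on (P x Fin.≟ j) (f x)

on-≤ : ∀ {X : Set} (X? : Dec X) {x y} → (X → x ≤ y) → on X? x ≤ y
on-≤ (yes h) f = f h
on-≤ (no _)  f = z≤n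

-- If `x` does not occur, the head is dropped instead, so that the length always decreases by
-- exactly one.
discard : ∀ {n k} (x : Fin n) js → Unique js → length js ≡ suc k →
          ∃ λ js′ → Unique js′ × length js′ ≡ k × x ∉ js′ × (∀ {j} → j ∈ js′ → j ∈ js)
discard x js u l with DecMembership._∈?_ Fin._≟_ x js
... | yes x∈ with extract x∈
... | js′ , p with Unique-↭ p u
... | x∉ ∷ u′ = js′ , u′ , suc-injective (≡.trans (≡.sym (Perm.↭-length p)) l) , All≢⇒∉ x∉ , λ j∈ → Perm.∈-resp-↭ (↭-sym p) (there j∈)
discard x (j ∷ js) (_ ∷ u) l | no x∉ = js , u , suc-injective l , (λ x∈ → x∉ (there x∈)) , there

total-single-on : ∀ {A Y : Set} {X : A → Set} (X? : ∀ x → Dec (X x)) (Y? : Dec Y) (c : ℕ) {x₀ xs} → Unique xs →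
                (∀ x → X x → x ≡ x₀ × Y) → total (λ x → on (X? x) c) xs ≤ on Y? c
total-single-on X? (yes _) c {x₀} u only = total-single X? (λ _ → c) {x₀} u (λ x h → proj₁ (only x h))
total-single-on X? (no ¬y) c {xs = xs} u only = ≤-reflexive (total-zero (All.universal (λ x → on-no (X? x) c (λ h → ¬y (proj₂ (only x h)))) xs))

-- As `t` is at least 1, a part is worth at least `4 * μ`; it cannot consist of one good below
-- `3 * μ`.
too-poor : ∀ {t x μ} → 0 < t → x < 3 * μ → ¬ (7 * t * μ ≤ x + 3 * μ)
too-poor {t} {x} {μ} 0<t x< h = 1+n≰n {0} (linear (suc x + 7 * 1 * μ) (3 * μ + (x + 3 * μ)) μ
  (+-mono-≤ x< (≤-trans (*-monoˡ-≤ μ (*-monoʳ-≤ 7 0<t)) h)) (identity x μ))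
  where
  identity : ∀ x μ → 1 + (3 * μ + (x + 3 * μ)) + μ ≡ 0 + (1 + x + 7 * 1 * μ)
  identity = solve-∀

module Types {m : ℕ} (G : Graph m) (inK : Fin m → Bool)
  (clique : ∀ u v → inK u ≡ true → inK v ≡ true → u ≢ v → adj G u v ≡ true)
  (independent : ∀ u v → inK u ≡ false → inK v ≡ false → adj G u v ≡ false)
  (k : ℕ) {n : ℕ} (type : Fin n → Fin (2 ^ k)) (w : Fin (2 ^ k) → Fin m → ℕ) (μ : Fin (2 ^ k) → ℕ)
  (P : Fin (2 ^ k) → Fin m → Fin n) where

  open SplitGraph G inK clique independent

  _≟ᴹ_ : DecidableEquality (Maybe (Fin n))
  _≟ᴹ_ = Maybeₚ.≡-dec Fin._≟_

  income : (Fin m → Maybe (Fin n)) → Fin n → ℕ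
  income own a = total (λ v → on (own v ≟ᴹ just a) (w (type a) v)) (allFin m)

  PartialAllocation : List (Fin n) → (Fin m → Bool) → Set
  PartialAllocation as R = ∃ λ own → (∀ v j → own v ≡ just j → R v ≡ true × j ∈ as) ×
    PartialHub own × (∀ {a} → a ∈ as → 3 * μ (type a) ≤ income own a)

  -- The invariant while single goods are given away: `R` marks the remaining goods, and for every
  -- type as many parts of its partition are untouched as agents remain.
  Alive : List (Fin n) → (Fin m → Bool) → Set
  Alive as R = ∀ s → ∃ λ js → Unique js × length js ≡ length as × (∀ v → P s v ∈ js → R v ≡ true)

  -- `rich` bounds the parts from below by `(7 * 2 ^ k − 3) * μ s`, written without subtraction; `w`
  -- is therefore already scaled relative to `μ`.
  module _ (hubs : ∀ s → Hub (P s)) (rich : ∀ s j → 7 * 2 ^ k * μ s ≤ worth (w s) (P s) j + 3 * μ s) where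

    private
      rich-type : ∀ {s j r} → worth (w s) (P s) j + 3 * μ s ≤ 2 ^ k * (r + 3 * μ s) → 4 * μ s ≤ r
      rich-type {s} {j} {r} h = +-cancelʳ-≤ (3 * μ s) (4 * μ s) r (≤-trans (≤-reflexive (seven (μ s)))
        (*-cancelˡ-≤ (2 ^ k) {{m^n≢0 2 k}} (≤-trans (≤-reflexive (commute (2 ^ k) (μ s))) (≤-trans (rich s j) h))))
        where
        seven : ∀ μ → 4 * μ + 3 * μ ≡ 7 * μ
        seven = solve-∀
        commute : ∀ t μ → t * (7 * μ) ≡ 7 * t * μ
        commute = solve-∀

    -- Once no single good satisfies anybody, the stars around clique vertices become the goods of a
    -- complete graph.
    module Stars (as : List (Fin n)) (R : Fin m → Bool) (alive : Alive as R)
      (small : ∀ {a} → a ∈ as → ∀ v → R v ≡ true → w (type a) v < 3 * μ (type a))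
      (χ : Fin m → Fin (2 ^ k))
      (χ-fair : ∀ s j B → (∀ v → P s v ≡ j → w s v ≤ B) → worth (w s) (P s) j + B ≤
        2 ^ k * (total (λ v → on ((P s v Fin.≟ j) ×-dec (χ v Fin.≟ s)) (w s v)) (allFin m) + B)) where

      Anchor : Fin (2 ^ k) → Fin m → Fin m → Set
      Anchor s v x = inK x ≡ true × P s x ≡ P s v × adj G v x ≡ true
      anchor? : ∀ s v → Dec (∃ (Anchor s v))
      anchor? s v = any? λ x → (inK x Boolₚ.≟ true) ×-dec ((P s x Fin.≟ P s v) ×-dec (adj G v x Boolₚ.≟ true))
      anchor : Fin (2 ^ k) → Fin m → Fin m
      anchor s v with inK v | anchor? s v
      ... | true  | _           = v
      ... | false | yes (x , _) = x
      -- By `anchor-ok` this is impossible for a remaining good and the type of a remaining agent.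
      -- For other types `v` stays out of all stars, since its anchor is not in the clique.
      ... | false | no _        = v
      anchor-clique : ∀ s {v} → inK v ≡ true → anchor s v ≡ v
      anchor-clique s {v} v∈K with inK v | anchor? s v
      ... | true | _ = ≡.refl
      anchor-adj : ∀ s v → anchor s v ≡ v ⊎ adj G v (anchor s v) ≡ true
      anchor-adj s v with inK v | anchor? s v
      ... | true  | _                    = inj₁ ≡.refl
      ... | false | yes (x , _ , _ , vx) = inj₂ vx
      ... | false | no _                 = inj₁ ≡.refl
      anchor-ok : ∀ {a v} → a ∈ as → R v ≡ true → inK (anchor (type a) v) ≡ true × P (type a) (anchor (type a) v) ≡ P (type a) v
      anchor-ok {a} {v} a∈ Rv with inK v in eq | anchor? (type a) v
      ... | true  | _ = eq , ≡.refl
      ... | false | yes (x , x∈K , Px , _) = x∈K , Px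
      ... | false | no none with hubs (type a) v eq
      ... | inj₁ h = contradiction h none
      ... | inj₂ alone = contradiction
        (≤-trans (rich (type a) (P (type a) v))
          (+-monoˡ-≤ (3 * μ (type a)) (total-single (λ u → P (type a) u Fin.≟ P (type a) v) (w (type a)) (allFin⁺ m) alone)))
        (too-poor (m^n>0 2 k) (small a∈ v Rv))

      f : Fin m → Fin m
      f v = anchor (χ v) v
      Good : Fin m → Fin m → Set
      Good x v = inK x ≡ true × R x ≡ true × R v ≡ true × f v ≡ x
      abstract
        good? : ∀ x v → Dec (Good x v)
        good? x v = (inK x Boolₚ.≟ true) ×-dec ((R x Boolₚ.≟ true) ×-dec ((R v Boolₚ.≟ true) ×-dec (f v Fin.≟ x)))
      W : Fin n → Fin m → ℕ
      W a x = total (λ v → on (good? x v) (w (type a) v)) (allFin m)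

      -- The bundles are the untouched parts of the type of `a`, restricted to the star centres. A
      -- good that `χ` assigns to this type is attached within its own part, so its value stays in
      -- that part.
      feasible : ∀ {a} → a ∈ as → Feasible (4 * μ (type a)) (length as) (map (W a) (allFin m))
      feasible {a} a∈ with alive (type a)
      ... | js , u , l , live = subst (λ t → Feasible (4 * μ s) t (map (W a) (allFin m))) l
        (Feasible-classes (P s) (W a) js (allFin m) u λ {j} j∈ →
          -- The bound `B` on a single good is `3 * μ s`, which matches the term `3 * μ s` in
          -- `rich`.
          ≤-trans (rich-type {s} {j} (χ-fair s j (3 * μ s) (λ x e → <⇒≤ (small a∈ x (live x (subst (_∈ js) (≡.sym e) j∈))))))
            (retained-in-stars j j∈))
        where
        open ≤-Reasoning
        s = type a
        retained-in-stars : ∀ j → j ∈ js → total (λ v → on ((P s v Fin.≟ j) ×-dec (χ v Fin.≟ s)) (w s v)) (allFin m) ≤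
                            total (λ x → on (P s x Fin.≟ j) (W a x)) (allFin m)
        retained-in-stars j j∈ = begin
          total (λ v → on ((P s v Fin.≟ j) ×-dec (χ v Fin.≟ s)) (w s v)) (allFin m)                            ≤⟨ total-mono (All.universal in-star (allFin m)) ⟩
          total (λ v → total (λ x → on (P s x Fin.≟ j) (on (good? x v) (w s v))) (allFin m)) (allFin m)        ≡⟨ total-swap (λ x v → on (P s x Fin.≟ j) (on (good? x v) (w s v))) (allFin m) (allFin m) ⟨
          total (λ x → total (λ v → on (P s x Fin.≟ j) (on (good? x v) (w s v))) (allFin m)) (allFin m)        ≤⟨ total-mono (All.universal (λ x → ≤-reflexive (≡.sym (total-on (P s x Fin.≟ j) _ (allFin m)))) (allFin m)) ⟩
          total (λ x → on (P s x Fin.≟ j) (W a x)) (allFin m)                                                  ∎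
          where
          in-star : ∀ v → on ((P s v Fin.≟ j) ×-dec (χ v Fin.≟ s)) (w s v) ≤ total (λ x → on (P s x Fin.≟ j) (on (good? x v) (w s v))) (allFin m)
          in-star v = on-≤ ((P s v Fin.≟ j) ×-dec (χ v Fin.≟ s)) λ (e , χv) → in-star′ e χv
            where
            in-star′ : P s v ≡ j → χ v ≡ s → w s v ≤ total (λ x → on (P s x Fin.≟ j) (on (good? x v) (w s v))) (allFin m)
            in-star′ e χv = ≤-trans (≤-reflexive (≡.sym (≡.trans (on-yes (P s (f v) Fin.≟ j) (on (good? (f v) v) (w s v)) Pf)
                (on-yes (good? (f v) v) (w s v) (f∈K , live (f v) (subst (_∈ js) (≡.sym Pf) j∈) , Rv , ≡.refl)))))
              (≤-total-∈ (λ x → on (P s x Fin.≟ j) (on (good? x v) (w s v))) (∈-allFin (f v)))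
              where
              Rv : R v ≡ true
              Rv = live v (subst (_∈ js) (≡.sym e) j∈)
              f-ok : inK (f v) ≡ true × P s (f v) ≡ P s v
              f-ok = subst (λ t → inK (anchor t v) ≡ true × P s (anchor t v) ≡ P s v) (≡.sym χv) (anchor-ok a∈ Rv)
              f∈K : inK (f v) ≡ true
              f∈K = proj₁ f-ok
              Pf : P s (f v) ≡ j
              Pf = ≡.trans (proj₂ f-ok) e

      module Assigned (ownK : Fin m → Fin n)
        (fair : ∀ {a} → a ∈ as → 3 * μ (type a) ≤ total (λ x → on (ownK x Fin.≟ a) (W a x)) (allFin m)) where

        Owned : Fin m → Set
        Owned v = inK (f v) ≡ true × R (f v) ≡ true × R v ≡ true × ownK (f v) ∈ as
        abstract
          owned? : ∀ v → Dec (Owned v)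
          owned? v = (inK (f v) Boolₚ.≟ true) ×-dec ((R (f v) Boolₚ.≟ true) ×-dec ((R v Boolₚ.≟ true) ×-dec DecMembership._∈?_ Fin._≟_ (ownK (f v)) as))
        own : Fin m → Maybe (Fin n)
        own v with owned? v
        ... | yes _ = just (ownK (f v))
        ... | no _  = nothing
        own-yes : ∀ {v} → Owned v → own v ≡ just (ownK (f v))
        own-yes {v} h with owned? v
        ... | yes _ = ≡.refl
        ... | no ¬h = contradiction h ¬h
        own-inv : ∀ {v j} → own v ≡ just j → Owned v × ownK (f v) ≡ j
        own-inv {v} eq with owned? v
        own-inv {v} ≡.refl | yes h = h , ≡.refl

        own-as : ∀ v j → own v ≡ just j → R v ≡ true × j ∈ as
        own-as v j eq with own-inv eq
        ... | (_ , _ , Rv , a∈) , ≡.refl = Rv , a∈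

        -- An owned vertex has its anchor in the clique, so an independent one is adjacent to its
        -- anchor. Clique vertices are their own anchors, hence the anchor has the same owner.
        own-hub : PartialHub own
        own-hub v j eq v∈I with own-inv eq
        ... | (f∈K , Rf , Rv , a∈) , ≡.refl with anchor-adj (χ v) v
        ... | inj₁ f≡v with ≡.trans (≡.sym v∈I) (≡.trans (cong inK (≡.sym f≡v)) f∈K)
        ... | ()
        own-hub v j eq v∈I | (f∈K , Rf , Rv , a∈) , ≡.refl | inj₂ vx =
          inj₁ (f v , f∈K , ≡.trans (own-yes (≡.subst₂ (λ x y → inK x ≡ true × R y ≡ true × R (f v) ≡ true × ownK y ∈ as) (≡.sym ff) (≡.sym ff) (f∈K , Rf , Rf , a∈))) (cong (λ t → just (ownK t)) ff) , vx)
          where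
          ff : f (f v) ≡ f v
          ff = anchor-clique (χ (f v)) f∈K

        own-income : ∀ {a} → a ∈ as → 3 * μ (type a) ≤ income own a
        own-income {a} a∈ = begin
          3 * μ (type a)                                                                                               ≤⟨ fair a∈ ⟩
          total (λ x → on (ownK x Fin.≟ a) (W a x)) (allFin m)                                                         ≤⟨ total-mono (All.universal (λ x → ≤-reflexive (total-on (ownK x Fin.≟ a) _ (allFin m))) (allFin m)) ⟩
          total (λ x → total (λ v → on (ownK x Fin.≟ a) (on (good? x v) (w (type a) v))) (allFin m)) (allFin m)        ≡⟨ total-swap (λ x v → on (ownK x Fin.≟ a) (on (good? x v) (w (type a) v))) (allFin m) (allFin m) ⟩
          total (λ v → total (λ x → on (ownK x Fin.≟ a) (on (good? x v) (w (type a) v))) (allFin m)) (allFin m)        ≤⟨ total-mono (All.universal counted (allFin m)) ⟩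
          income own a                                                                                                 ∎
          where
          open ≤-Reasoning
          on-on : ∀ {X Y : Set} (X? : Dec X) (Y? : Dec Y) c → on X? (on Y? c) ≤ on (X? ×-dec Y?) c
          on-on (yes _) (yes _) c = ≤-refl
          on-on (yes _) (no _)  c = z≤n
          on-on (no _)  _       c = z≤n
          -- The good `v` lies in no star but the one around `f v`, so it is counted at most once.
          counted : ∀ v → total (λ x → on (ownK x Fin.≟ a) (on (good? x v) (w (type a) v))) (allFin m) ≤ on (own v ≟ᴹ just a) (w (type a) v)
          counted v = ≤-trans (total-mono (All.universal (λ x → on-on (ownK x Fin.≟ a) (good? x v) (w (type a) v)) (allFin m)))
            (total-single-on (λ x → (ownK x Fin.≟ a) ×-dec good? x v) (own v ≟ᴹ just a) (w (type a) v) (allFin⁺ m)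
              λ { x (≡.refl , x∈K , Rx , Rv , ≡.refl) → ≡.refl , own-yes (x∈K , Rx , Rv , a∈) })

        result : PartialAllocation as R
        result = own , own-as , own-hub , own-income

      stars : Fin n → PartialAllocation as R
      stars d = assigned (complete-graph W (λ a → μ (type a)) d as feasible)
        where
        assigned : (∃ λ ownK → ∀ {a} → a ∈ as → 3 * μ (type a) ≤ total (λ x → on (ownK x Fin.≟ a) (W a x)) (allFin m)) →
                   PartialAllocation as R
        assigned (ownK , fair) = Assigned.result ownK fair

    -- A good worth `3 * μ` to some agent is given to it. Every type loses at most the part of that
    -- good; if this part had been discarded before, another one is dropped to keep the count.
    -- Without such a good, the stars take over.
    allocate : Fin n → ∀ l as R → length as ≡ l → Unique as → Alive as R → PartialAllocation as R
    allocate d zero [] R _ _ _ = (λ _ → nothing) , (λ _ _ ()) , (λ _ _ ()) , λ ()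
    allocate d (suc l) as R len uas alive
      with Any.any? (λ a → any? (λ v → (R v Boolₚ.≟ true) ×-dec (3 * μ (type a) ≤? w (type a) v))) as
    ... | no none = fair-stars (distribute k Fin._≟_ P w)
      where
      small : ∀ {a} → a ∈ as → ∀ v → R v ≡ true → w (type a) v < 3 * μ (type a)
      small a∈ v Rv = ≰⇒> (λ h → none (lose a∈ (v , Rv , h)))
      fair-stars : (∃ λ χ → ∀ s j B → (∀ v → P s v ≡ j → w s v ≤ B) → worth (w s) (P s) j + B ≤
        2 ^ k * (total (λ v → on ((P s v Fin.≟ j) ×-dec (χ v Fin.≟ s)) (w s v)) (allFin m) + B)) → PartialAllocation as R
      fair-stars (χ , χ-fair) = Stars.stars as R alive small χ χ-fair d
    ... | yes some with extract-any some
    ... | a , as′ , (v , Rv , big) , p with Unique-↭ p uas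
    ... | a∉ ∷ uas′ = give-good (allocate d l as′ R′ len′ uas′ alive′)
      where
      R′ : Fin m → Bool
      R′ u with u Fin.≟ v
      ... | yes _ = false
      ... | no _  = R u
      R′⁺ : ∀ {u} → u ≢ v → R u ≡ true → R′ u ≡ true
      R′⁺ {u} u≢v Ru with u Fin.≟ v
      ... | yes u≡v = contradiction u≡v u≢v
      ... | no _    = Ru
      R′⁻ : ∀ {u} → R′ u ≡ true → u ≢ v × R u ≡ true
      R′⁻ {u} h with u Fin.≟ v
      R′⁻ {u} () | yes _
      ... | no u≢v = u≢v , h
      len′ : length as′ ≡ l
      len′ = suc-injective (≡.trans (≡.sym (Perm.↭-length p)) len)
      alive′ : Alive as′ R′
      alive′ s with alive s
      ... | js , ujs , ljs , live with discard (P s v) js ujs (≡.trans ljs len)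
      ... | js′ , ujs′ , ljs′ , v∉ , sub = js′ , ujs′ , ≡.trans ljs′ (≡.sym len′) ,
        λ u u∈ → R′⁺ (λ { ≡.refl → v∉ u∈ }) (live u (sub u∈))
      give-good : PartialAllocation as′ R′ → PartialAllocation as R
      give-good (own , own-as , own-hub , own-income) = own′ , own′-as , own′-hub , own′-income
        where
        own′ : Fin m → Maybe (Fin n)
        own′ u with u Fin.≟ v
        ... | yes _ = just a
        ... | no _  = own u
        own′-v : own′ v ≡ just a
        own′-v with v Fin.≟ v
        ... | yes _  = ≡.refl
        ... | no v≢v = contradiction ≡.refl v≢v
        own′-old : ∀ u {j} → own u ≡ just j → own′ u ≡ just j
        own′-old u {j} eq with u Fin.≟ v
        ... | yes ≡.refl = contradiction ≡.refl (proj₁ (R′⁻ {v} (proj₁ (own-as v j eq))))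
        ... | no _ = eq
        own′-inv : ∀ u {j} → own′ u ≡ just j → (u ≡ v × a ≡ j) ⊎ own u ≡ just j
        own′-inv u eq with u Fin.≟ v
        own′-inv u ≡.refl | yes u≡v = inj₁ (u≡v , ≡.refl)
        ... | no _ = inj₂ eq
        a-new : ∀ u → own u ≢ just a
        a-new u eq = All≢⇒∉ a∉ (proj₂ (own-as u a eq))
        own′-as : ∀ u j → own′ u ≡ just j → R u ≡ true × j ∈ as
        own′-as u j eq with own′-inv u eq
        ... | inj₁ (≡.refl , ≡.refl) = Rv , Perm.∈-resp-↭ (↭-sym p) (here ≡.refl)
        ... | inj₂ old = proj₂ (R′⁻ {u} (proj₁ (own-as u j old))) , Perm.∈-resp-↭ (↭-sym p) (there (proj₂ (own-as u j old)))
        own′-hub : PartialHub own′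
        own′-hub u j eq u∈I with own′-inv u eq
        -- As `a` is not among the agents of the recursive call, `v` is its whole bundle.
        own′-hub u j eq u∈I | inj₁ (≡.refl , ≡.refl) = inj₂ alone
          where
          alone : ∀ u → own′ u ≡ just a → u ≡ v
          alone u e with own′-inv u e
          ... | inj₁ (u≡v , _) = u≡v
          ... | inj₂ old = contradiction old (a-new _)
        own′-hub u j eq u∈I | inj₂ old with own-hub u j old u∈I
        ... | inj₁ (x , x∈K , ox , ux) = inj₁ (x , x∈K , own′-old x ox , ux)
        ... | inj₂ alone = inj₂ alone′
          where
          alone′ : ∀ u′ → own′ u′ ≡ just j → u′ ≡ u
          alone′ u′ e with own′-inv u′ e
          ... | inj₁ (_ , ≡.refl) = contradiction old (a-new _)
          ... | inj₂ old′ = alone u′ old′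
        own′-income : ∀ {i} → i ∈ as → 3 * μ (type i) ≤ income own′ i
        own′-income i∈ with Perm.∈-resp-↭ p i∈
        ... | here ≡.refl = ≤-trans big (≤-trans (≤-reflexive (≡.sym (on-yes (own′ v ≟ᴹ just a) (w (type a) v) own′-v)))
          (≤-total-∈ (λ u → on (own′ u ≟ᴹ just a) (w (type a) u)) (∈-allFin v)))
        own′-income {i} i∈ | there i∈′ = ≤-trans (own-income i∈′)
          (total-mono (All.universal (λ u → on-mono (own u ≟ᴹ just i) (own′ u ≟ᴹ just i) (λ old → own′-old u old , ≤-refl)) (allFin m)))

    allocation : Connected G → Fin n → ∃ λ A → Hub A × (∀ a → 3 * μ (type a) ≤ worth (w (type a)) A a)
    allocation connected d = complete-it (allocate d n (allFin n) (λ _ → true) (length-tabulate id) (allFin⁺ n)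
        (λ s → allFin n , allFin⁺ n , ≡.refl , λ _ _ → ≡.refl))
      where
      complete-it : PartialAllocation (allFin n) (λ _ → true) → ∃ λ A → Hub A × (∀ a → 3 * μ (type a) ≤ worth (w (type a)) A a)
      complete-it (own , _ , own-hub , own-income) with extend connected d own own-hub
      ... | A , hub , extends = A , hub , λ a → ≤-trans (own-income (∈-allFin a))
        (total-mono (All.universal (λ v → on-mono (own v ≟ᴹ just a) (A v Fin.≟ a) (λ e → extends v a e , ≤-refl)) (allFin m)))

-- Clearing denominators

ι : ℕ → ℚ
ι n = mkℚ (ℤ.+ n) 0 (Coprime.sym (Coprime.1-coprimeTo n))

ι-+ : ∀ a b → ι a ℚ.+ ι b ≡ ι (a + b)
ι-+ a b = ℚₚ.toℚᵘ-injective (ℚᵘₚ.≃-trans (ℚₚ.toℚᵘ-homo-+ (ι a) (ι b))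
  (ℚᵘ.*≡* (cong (ℤ._* ℤ.1ℤ) (cong₂ ℤ._+_ (ℤₚ.*-identityʳ (ℤ.+ a)) (ℤₚ.*-identityʳ (ℤ.+ b))))))

ι-* : ∀ a b → ι a ℚ.* ι b ≡ ι (a * b)
ι-* a b = ℚₚ.toℚᵘ-injective (ℚᵘₚ.≃-trans (ℚₚ.toℚᵘ-homo-* (ι a) (ι b))
  (ℚᵘ.*≡* (cong (ℤ._* ℤ.1ℤ) (≡.sym (ℤₚ.pos-* a b)))))

ι-mono-≤ : ∀ {a b} → a ≤ b → ι a ℚ.≤ ι b
ι-mono-≤ {a} {b} a≤b = *≤* (≡.subst₂ ℤ._≤_ (≡.sym (ℤₚ.*-identityʳ (ℤ.+ a))) (≡.sym (ℤₚ.*-identityʳ (ℤ.+ b))) (ℤ.+≤+ a≤b))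

ι-cancel-≤ : ∀ {a b} → ι a ℚ.≤ ι b → a ≤ b
ι-cancel-≤ {a} {b} (*≤* h) = ℤₚ.drop‿+≤+ (≡.subst₂ ℤ._≤_ (ℤₚ.*-identityʳ (ℤ.+ a)) (ℤₚ.*-identityʳ (ℤ.+ b)) h)

ι-/ : ∀ a d .{{_ : NonZero d}} → ι d ℚ.* ((ℤ.+ a) ℚ./ d) ≡ ι a
ι-/ a d@(suc d-1) = ℚₚ.toℚᵘ-injective (ℚᵘₚ.≃-trans (ℚₚ.toℚᵘ-homo-* (ι d) ((ℤ.+ a) ℚ./ d))
  (ℚᵘₚ.≃-trans (ℚᵘₚ.*-congˡ {toℚᵘ (ι d)} (ℚₚ.toℚᵘ-fromℚᵘ (ℚᵘ.mkℚᵘ (ℤ.+ a) d-1)))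
    (ℚᵘ.*≡* (≡.trans (ℤₚ.*-identityʳ _) (≡.trans (ℤₚ.*-comm (ℤ.+ d) (ℤ.+ a)) (cong (ℤ.+ a ℤ.*_) (≡.sym (cong (λ t → ℤ.+ t) (*-identityˡ d)))))))))

ι-positive : ∀ {n} → 0 < n → ℚ.Positive (ι n)
ι-positive {suc n} _ = _

nonneg-numerator : ∀ p → 0ℚ ℚ.≤ p → ∃₂ λ d a → 0 < d × ι d ℚ.* p ≡ ι a
nonneg-numerator p@(mkℚ (ℤ.+ a) d-1 _) _ = suc d-1 , a , s≤s z≤n ,
  ≡.trans (cong (ι (suc d-1) ℚ.*_) (≡.sym (ℚₚ.↥p/↧p≡p p))) (ι-/ a (suc d-1))
nonneg-numerator (mkℚ ℤ.-[1+ _ ] _ _) (*≤* ())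

clear-denominators : ∀ {m} (u : Utility m) → Nonneg u →
                     ∃₂ λ D (w : Fin m → ℕ) → 0 < D × (∀ v → ι D ℚ.* u v ≡ ι (w v))
clear-denominators {zero} u _ = 1 , (λ ()) , s≤s z≤n , λ ()
clear-denominators {suc m} u nonneg
  with nonneg-numerator (u Fin.zero) (nonneg Fin.zero) | clear-denominators (λ v → u (Fin.suc v)) (λ v → nonneg (Fin.suc v))
... | d , a , 0<d , eq | D , w , 0<D , eqs = d * D , w′ , *-mono-≤ 0<d 0<D , eqs′
  where
  w′ : Fin (suc m) → ℕ
  w′ Fin.zero    = D * a
  w′ (Fin.suc v) = d * w v
  eqs′ : ∀ v → ι (d * D) ℚ.* u v ≡ ι (w′ v)
  eqs′ Fin.zero = begin
    ι (d * D) ℚ.* u Fin.zero         ≡⟨ cong (λ t → ι t ℚ.* u Fin.zero) (*-comm d D) ⟩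
    ι (D * d) ℚ.* u Fin.zero         ≡⟨ cong (ℚ._* u Fin.zero) (ι-* D d) ⟨
    (ι D ℚ.* ι d) ℚ.* u Fin.zero     ≡⟨ ℚₚ.*-assoc (ι D) (ι d) _ ⟩
    ι D ℚ.* (ι d ℚ.* u Fin.zero)     ≡⟨ cong (ι D ℚ.*_) eq ⟩
    ι D ℚ.* ι a                      ≡⟨ ι-* D a ⟩
    ι (D * a)                        ∎
    where open ≡.≡-Reasoning
  eqs′ (Fin.suc v) = begin
    ι (d * D) ℚ.* u (Fin.suc v)      ≡⟨ cong (ℚ._* u (Fin.suc v)) (ι-* d D) ⟨
    (ι d ℚ.* ι D) ℚ.* u (Fin.suc v)  ≡⟨ ℚₚ.*-assoc (ι d) (ι D) _ ⟩
    ι d ℚ.* (ι D ℚ.* u (Fin.suc v))  ≡⟨ cong (ι d ℚ.*_) (eqs v) ⟩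
    ι d ℚ.* ι (w v)                  ≡⟨ ι-* d (w v) ⟩
    ι (d * w v)                      ∎
    where open ≡.≡-Reasoning

scaled-sum : ∀ m D (f : Fin m → ℚ) (g : Fin m → ℕ) → (∀ v → ι D ℚ.* f v ≡ ι (g v)) →
             ι D ℚ.* sumFin m f ≡ ι (total g (allFin m))
scaled-sum zero D f g _ = ℚₚ.*-zeroʳ (ι D)
scaled-sum (suc m) D f g eq = begin
  ι D ℚ.* (f Fin.zero ℚ.+ sumFin m (λ v → f (Fin.suc v)))                    ≡⟨ ℚₚ.*-distribˡ-+ (ι D) (f Fin.zero) _ ⟩
  ι D ℚ.* f Fin.zero ℚ.+ ι D ℚ.* sumFin m (λ v → f (Fin.suc v))              ≡⟨ cong₂ ℚ._+_ (eq Fin.zero) (scaled-sum m D _ (λ v → g (Fin.suc v)) (λ v → eq (Fin.suc v))) ⟩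
  ι (g Fin.zero) ℚ.+ ι (total (λ v → g (Fin.suc v)) (allFin m))              ≡⟨ ι-+ (g Fin.zero) _ ⟩
  ι (g Fin.zero + total (λ v → g (Fin.suc v)) (allFin m))                    ≡⟨ cong (λ t → ι (g Fin.zero + sum t)) (≡.trans (map-tabulate id (λ v → g (Fin.suc v))) (≡.sym (map-tabulate Fin.suc g))) ⟩
  ι (total g (allFin (suc m)))                                               ∎
  where open ≡.≡-Reasoning

scaled-value : ∀ {m n} D (u : Utility m) (w : Fin m → ℕ) → (∀ v → ι D ℚ.* u v ≡ ι (w v)) →
               ∀ (A : Assignment m n) j → ι D ℚ.* value u (part A j) ≡ ι (worth w A j)
scaled-value {m} D u w eq A j = scaled-sum m D _ _ term
  where
  term : ∀ v → ι D ℚ.* (if part A j v then u v else 0ℚ) ≡ ι (on (A v Fin.≟ j) (w v))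
  term v with A v Fin.≟ j
  ... | yes _ = eq v
  ... | no _  = ℚₚ.*-zeroʳ (ι D)

-- From integer weights to rational utilities

theorem4 : (k : ℕ) {m : ℕ} (G : Graph m) → Connected G → IsSplit G →
    (n : ℕ) → n ≥ 1 → (u : Fin n → Utility m) →
    (∀ i → Nonneg (u i)) → AtMostTypes (2 ^ k) u →
    Σ (Assignment m n) λ A → IsPartition G n A ×
    (∀ (i : Fin n) (μ : ℚ) → IsMMS G n (u i) μ →
    α k ℚ.* μ ℚ.≤ value (u i) (part A i))
theorem4 k {m} G connected (inK , clique , independent) (suc n) _ u nonneg (T , typed) =
  A , Hub⇒partition A-hub , satisfied
  where
  open SplitGraph G inK clique independent

  type : Fin (suc n) → Fin (2 ^ k)
  type i = proj₁ (typed i)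
  -- Each type is represented by one of its agents, whose utilities are nonnegative; `T s` might not
  -- be if no agent has type `s`, and agent zero stands in for such a type.
  agent-of : Fin (2 ^ k) → Fin (suc n)
  agent-of s with any? (λ i → type i Fin.≟ s)
  ... | yes (i , _) = i
  ... | no _        = Fin.zero
  agent-of-type : ∀ i → type (agent-of (type i)) ≡ type i
  agent-of-type i with any? (λ i′ → type i′ Fin.≟ type i)
  ... | yes (_ , e) = e
  ... | no none     = contradiction (i , ≡.refl) none
  same-utility : ∀ i v → u (agent-of (type i)) v ≡ u i v
  same-utility i v = ≡.trans (proj₂ (typed (agent-of (type i))) v)
    (≡.trans (cong (λ s → T s v) (agent-of-type i)) (≡.sym (proj₂ (typed i) v)))

  cleared : ∀ s → ∃₂ λ D (w : Fin m → ℕ) → 0 < D × (∀ v → ι D ℚ.* u (agent-of s) v ≡ ι (w v))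
  cleared s = clear-denominators (u (agent-of s)) (nonneg (agent-of s))
  D : Fin (2 ^ k) → ℕ
  D s = proj₁ (cleared s)
  w : Fin (2 ^ k) → Fin m → ℕ
  w s = proj₁ (proj₂ (cleared s))

  best : ∀ s → ∃₂ λ μ (P : Fin m → Fin (suc n)) →
    Hub P × (∀ j → μ ≤ worth (w s) P j) × (∀ Q ν → Hub Q → (∀ j → ν ≤ worth (w s) Q j) → ν ≤ μ)
  best s = best-partition connected Fin.zero (w s)
  μ : Fin (2 ^ k) → ℕ
  μ s = proj₁ (best s)
  P : Fin (2 ^ k) → Fin m → Fin (suc n)
  P s = proj₁ (proj₂ (best s))

  scale-worth : ∀ c (w : Fin m → ℕ) (Q : Fin m → Fin (suc n)) j → worth (λ v → c * w v) Q j ≡ c * worth w Q j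
  scale-worth c w Q j = go (allFin m)
    where
    go : ∀ vs → total (λ v → on (Q v Fin.≟ j) (c * w v)) vs ≡ c * total (λ v → on (Q v Fin.≟ j) (w v)) vs
    go [] = ≡.sym (*-zeroʳ c)
    go (v ∷ vs) = ≡.trans (cong₂ _+_ (head (Q v Fin.≟ j)) (go vs)) (≡.sym (*-distribˡ-+ c (on (Q v Fin.≟ j) (w v)) _))
      where
      head : ∀ {X : Set} (X? : Dec X) → on X? (c * w v) ≡ c * on X? (w v)
      head (yes _) = ≡.refl
      head (no _)  = ≡.sym (*-zeroʳ c)

  -- Scaling the weights by `den k` makes a part of worth `μ s` worth `(7 * 2 ^ k − 3) * μ s`, while
  -- `μ s` itself remains the unit: the satisfaction level is `3 * μ s`.
  rich : ∀ s j → 7 * 2 ^ k * μ s ≤ worth (λ v → den k * w s v) (P s) j + 3 * μ s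
  rich s j = begin
    7 * 2 ^ k * μ s                                        ≡⟨ cong (_* μ s) (≡.sym (m∸n+n≡m {7 * 2 ^ k} {3} (≤-trans (s≤s (s≤s (s≤s z≤n))) (*-monoʳ-≤ 7 (m^n>0 2 k))))) ⟩
    (den k + 3) * μ s                                      ≡⟨ *-distribʳ-+ (μ s) (den k) 3 ⟩
    den k * μ s + 3 * μ s                                  ≤⟨ +-monoˡ-≤ (3 * μ s) (*-monoʳ-≤ (den k) (proj₁ (proj₂ (proj₂ (proj₂ (best s)))) j)) ⟩
    den k * worth (w s) (P s) j + 3 * μ s                  ≡⟨ cong (_+ 3 * μ s) (scale-worth (den k) (w s) (P s) j) ⟨
    worth (λ v → den k * w s v) (P s) j + 3 * μ s          ∎
    where open ≤-Reasoning

  solution : ∃ λ A → Hub A × (∀ i → 3 * μ (type i) ≤ worth (λ v → den k * w (type i) v) A i)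
  solution = Types.allocation G inK clique independent k type (λ s v → den k * w s v) μ P
    (λ s → proj₁ (proj₂ (proj₂ (best s)))) rich connected Fin.zero

  A : Assignment m (suc n)
  A = proj₁ solution
  A-hub : Hub A
  A-hub = proj₁ (proj₂ solution)

  satisfied : ∀ i μᵢ → IsMMS G (suc n) (u i) μᵢ → α k ℚ.* μᵢ ℚ.≤ value (u i) (part A i)
  satisfied i μᵢ ((Q , Q-partition , μᵢ≤ , j₀ , attained) , _) =
    ℚₚ.*-cancelˡ-≤-pos (ι (den k * D s)) {{ι-positive (*-mono-≤ (den>0 k) 0<D)}} (begin
      ι (den k * D s) ℚ.* (α k ℚ.* μᵢ)                  ≡⟨ cong (ℚ._* (α k ℚ.* μᵢ)) (ι-* (den k) (D s)) ⟨
      (ι (den k) ℚ.* ι (D s)) ℚ.* (α k ℚ.* μᵢ)          ≡⟨ interchange (ι (den k)) (ι (D s)) (α k) μᵢ ⟩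
      (ι (den k) ℚ.* α k) ℚ.* (ι (D s) ℚ.* μᵢ)          ≡⟨ cong₂ ℚ._*_ (ι-/ 3 (den k) {{>-nonZero (den>0 k)}}) (≡.trans (cong (ι (D s) ℚ.*_) (≡.sym attained)) (scaled Q j₀)) ⟩
      ι 3 ℚ.* ι ν                                       ≡⟨ ι-* 3 ν ⟩
      ι (3 * ν)                                         ≤⟨ ι-mono-≤ (≤-trans (*-monoʳ-≤ 3 ν≤μ) (≤-trans (proj₂ (proj₂ solution) i) (≤-reflexive (scale-worth (den k) (w s) A i)))) ⟩
      ι (den k * worth (w s) A i)                       ≡⟨ ι-* (den k) (worth (w s) A i) ⟨
      ι (den k) ℚ.* ι (worth (w s) A i)                 ≡⟨ cong (ι (den k) ℚ.*_) (scaled A i) ⟨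
      ι (den k) ℚ.* (ι (D s) ℚ.* value (u i) (part A i)) ≡⟨ ℚₚ.*-assoc (ι (den k)) (ι (D s)) _ ⟨
      (ι (den k) ℚ.* ι (D s)) ℚ.* value (u i) (part A i) ≡⟨ cong (ℚ._* value (u i) (part A i)) (ι-* (den k) (D s)) ⟩
      ι (den k * D s) ℚ.* value (u i) (part A i)         ∎)
    where
    open ℚₚ.≤-Reasoning
    s = type i
    0<D : 0 < D s
    0<D = proj₁ (proj₂ (proj₂ (cleared s)))
    scaled : ∀ (B : Assignment m (suc n)) j → ι (D s) ℚ.* value (u i) (part B j) ≡ ι (worth (w s) B j)
    scaled = scaled-value (D s) (u i) (w s) (λ v → ≡.trans (cong (ι (D s) ℚ.*_) (≡.sym (same-utility i v))) (proj₂ (proj₂ (proj₂ (cleared s))) v))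
    -- The rational share is attained by a part of `Q`, so multiplication by `D s` turns it into the
    -- natural number `ν`. As `Q` is a candidate for `best-partition`, `ν` is at most `μ s`.
    ν : ℕ
    ν = worth (w s) Q j₀
    ν≤μ : ν ≤ μ s
    ν≤μ = proj₂ (proj₂ (proj₂ (proj₂ (best s)))) Q ν (partition⇒Hub Q-partition) λ j →
      ι-cancel-≤ (≡.subst₂ ℚ._≤_ (≡.trans (cong (ι (D s) ℚ.*_) (≡.sym attained)) (scaled Q j₀)) (scaled Q j)
        (ℚₚ.*-monoˡ-≤-nonNeg (ι (D s)) (μᵢ≤ j)))
    interchange : ∀ a b c d → (a ℚ.* b) ℚ.* (c ℚ.* d) ≡ (a ℚ.* c) ℚ.* (b ℚ.* d)
    interchange a b c d = ≡.trans (ℚₚ.*-assoc a b _) (≡.trans (cong (a ℚ.*_)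
      (≡.trans (≡.sym (ℚₚ.*-assoc b c d)) (≡.trans (cong (ℚ._* d) (ℚₚ.*-comm b c)) (ℚₚ.*-assoc c b d)))) (≡.sym (ℚₚ.*-assoc a c _)))
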